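{- Let $\sigma$ be any pattern (a fixed permutation), and let $$h_{\sigma} = \lim_{n \rightarrow \infty} \sum_{i=1}^{n-1-|\sigma|} \frac{|Av_i(\sigma)|}{(i-1)!}=\sum_{i=1}^{\infty}\frac{|Av_i(\sigma)|}{(i-1)!},$$ which is finite. If $\pi$ is a uniformly random permutation of size $n$, then $$\mathrm{Prob}(\pi \notin Av_n(\sigma;2)) \sim \frac{2 h_{\sigma}}{n^2}\qquad (n\to\infty).$$
   Context: $\mathcal{S}_n$ is the set of permutations $\pi=\pi_1\pi_2\dots\pi_n$ of $\{1,\dots,n\}$ in one-line notation. Write $\sigma\prec\pi$ if $\pi$ contains the pattern $\sigma$ in the classical sense (some subsequence of $\pi$, not necessarily consecutive, is order-isomorphic to $\sigma$), and $\sigma\nprec\pi$ otherwise. $Av_n(\sigma)=\{\pi\in\mathcal{S}_n:\sigma\nprec\pi\}$, and $|\sigma|$ is the size of $\sigma$. For an entry $k$ of $\pi$, let $s_\pi(k)$ be the biggest sub-string (block of consecutive positions) of $\pi$ that contains the entry $k$ and all of whose entries are greater than or equal to $k$. The sub-permutation of $\pi$ generated by $k$, denoted $g_\pi(k)$, is the permutation obtained by rescaling $s_\pi(k)$ (replacing its entries by $1,2,\dots,|s_\pi(k)|$ in an order-preserving way). For a pattern $\sigma$ and an integer $k\ge 1$, $Av(\sigma;k)$ is the set of permutations $\pi$ for which: $\pi$ avoids $\sigma$ if and only if $g_\pi(k)$ avoids $\sigma$. Equivalently, if $\sigma\prec\pi$ then $\sigma\prec g_\pi(k)$. $Av_n(\sigma;k)=Av(\sigma;k)\cap\mathcal{S}_n$.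 Thus $\pi\notin Av_n(\sigma;k)$ means $\sigma\prec\pi$ and $\sigma\nprec g_\pi(k)$. $f(n)\sim g(n)$ denotes asymptotic equivalence, $f(n)-g(n)=o(g(n))$ as $n\to\infty$. -}

module Defs where

open import Data.Nat.Base using (ℕ; zero; suc; _≤_; _<_; _^_; _!; _⊔_; NonZero; >-nonZero)
import Data.Nat.Properties as ℕ
open import Data.Integer.Base using (+_)
open import Data.Rational.Base as ℚ using (ℚ; 0ℚ; 1ℚ; ½; _/_)
import Data.Rational.Properties as ℚ
open import Data.List.Base
  using (List; []; _∷_; _++_; length; map; filter; zip; reverse; takeWhile; break;
         applyUpTo; cartesianProductWith)
open import Data.List.Properties using (length-applyUpTo)
open import Data.List.Membership.Propositional using (_∈_; find; lose)
open import Data.List.Membership.Propositional.Properties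
  using (∈-filter⁺; ∈-length; ∈-cartesianProductWith⁺; ∈-applyUpTo⁺; ∈-map⁺; ∈-map⁻;
         ∈-++⁺ˡ; ∈-++⁺ʳ; ∈-++⁻)
open import Data.List.Relation.Unary.All using (All; []; _∷_; tabulate)
open import Data.List.Relation.Unary.AllPairs using (AllPairs; allPairs?)
open import Data.List.Relation.Unary.Any using (here; any?)
open import Data.List.Relation.Unary.Unique.DecPropositional ℕ._≟_ using (Unique; unique?)
import Data.List.Relation.Unary.Unique.Propositional.Properties as Unique
open import Data.List.Relation.Binary.Sublist.Propositional using (_⊆_; []; _∷_; _∷ʳ_)
open import Data.Product.Base using (_×_; _,_; ∃-syntax; uncurry)
open import Data.Sum.Base using (inj₁; inj₂)
open import Function.Bundles using (_⇔_; mk⇔; Equivalence)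
open import Level using (Level)
open import Relation.Nullary.Decidable using (Dec; map′; ¬?; _×-dec_; _→-dec_)
open import Relation.Nullary.Negation using (¬_)
open import Relation.Unary using (Pred; Decidable)
open import Relation.Binary.PropositionalEquality
  using (_≡_; refl; sym; trans; cong; cong₂; subst)

private variable
  a p : Level
  A B : Set a

infix  4 _≺_ _≺?_ _∈Av[_؛_] _∈Av?[_؛_] _≤ʳ_ _⟶_ _∼_
infixl 6 _-ʳ_
infixr 7 _·ʳ_

------------------------------------------------------------------------
-- Permutations in one-line notation

[1⋯_] : ℕ → List ℕ
[1⋯ n ] = applyUpTo suc n

words : List A → ℕ → List (List A)
words as zero    = [] ∷ []
words as (suc m) = cartesianProductWith _∷_ as (words as m)

-- The words of length n over {1,…,n} without repeated entries, each listed
-- exactly once.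
𝒮 : ℕ → List (List ℕ)
𝒮 n = filter unique? (words [1⋯ n ] n)

∈-words : ∀ {as xs : List A} → All (_∈ as) xs → xs ∈ words as (length xs)
∈-words []         = here refl
∈-words (x∈ ∷ xs∈) = ∈-cartesianProductWith⁺ _∷_ x∈ (∈-words xs∈)

identity∈𝒮 : ∀ n → [1⋯ n ] ∈ 𝒮 n
identity∈𝒮 n = ∈-filter⁺ unique?
  (subst (λ l → [1⋯ n ] ∈ words [1⋯ n ] l) (length-applyUpTo suc n) (∈-words (tabulate (λ x∈ → x∈))))
  (Unique.applyUpTo⁺₁ suc n (λ i<j _ eq → ℕ.<⇒≢ i<j (ℕ.suc-injective eq)))

∣𝒮∣≢0 : ∀ n → NonZero (length (𝒮 n))
∣𝒮∣≢0 n = >-nonZero (∈-length (identity∈𝒮 n))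

------------------------------------------------------------------------
-- Pattern containment

-- a , b are the entries of the two words at one position, c , d those at another.
SameOrder : ℕ × ℕ → ℕ × ℕ → Set
SameOrder (a , b) (c , d) = (a < c ⇔ b < d) × (c < a ⇔ d < b)

OrderIsomorphic : List ℕ → List ℕ → Set
OrderIsomorphic xs ys = length xs ≡ length ys × AllPairs SameOrder (zip xs ys)

-- _⊆_ is the (not necessarily contiguous) subsequence relation.
_≺_ : List ℕ → List ℕ → Set
σ ≺ π = ∃[ τ ] (τ ⊆ π × OrderIsomorphic τ σ)

_⇔-dec_ : Dec A → Dec B → Dec (A ⇔ B)
a? ⇔-dec b? = map′ (uncurry mk⇔) (λ e → Equivalence.to e , Equivalence.from e)
  ((a? →-dec b?) ×-dec (b? →-dec a?))

orderIsomorphic? : ∀ xs ys → Dec (OrderIsomorphic xs ys)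
orderIsomorphic? xs ys = (length xs ℕ.≟ length ys) ×-dec
  allPairs? (λ { (a , b) (c , d) → ((a ℕ.<? c) ⇔-dec (b ℕ.<? d)) ×-dec
                                   ((c ℕ.<? a) ⇔-dec (d ℕ.<? b)) }) (zip xs ys)

sublists : List A → List (List A)
sublists []       = [] ∷ []
sublists (x ∷ xs) = map (x ∷_) (sublists xs) ++ sublists xs

∈-sublists⁺ : ∀ {xs ys : List A} → xs ⊆ ys → xs ∈ sublists ys
∈-sublists⁺ []              = here refl
∈-sublists⁺ (y ∷ʳ xs⊆)      = ∈-++⁺ʳ _ (∈-sublists⁺ xs⊆)
∈-sublists⁺ (refl ∷ xs⊆)    = ∈-++⁺ˡ (∈-map⁺ _ (∈-sublists⁺ xs⊆))

∈-sublists⁻ : ∀ {xs} (ys : List A) → xs ∈ sublists ys → xs ⊆ ys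
∈-sublists⁻ []       (here refl) = []
∈-sublists⁻ (y ∷ ys) xs∈ with ∈-++⁻ (map (y ∷_) (sublists ys)) xs∈
... | inj₂ xs∈′ = y ∷ʳ ∈-sublists⁻ ys xs∈′
... | inj₁ xs∈′ with ∈-map⁻ (y ∷_) xs∈′
...   | _ , zs∈ , refl = refl ∷ ∈-sublists⁻ ys zs∈

_≺?_ : ∀ σ π → Dec (σ ≺ π)
σ ≺? π = map′
  (λ any → let τ , τ∈ , iso = find any in τ , ∈-sublists⁻ π τ∈ , iso)
  (λ (_ , τ⊆π , iso) → lose (∈-sublists⁺ τ⊆π) iso)
  (any? (λ τ → orderIsomorphic? τ σ) (sublists π))

∣Av_∣ : ℕ → List ℕ → ℕ
∣Av n ∣ σ = length (filter (λ π → ¬? (σ ≺? π)) (𝒮 n))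

------------------------------------------------------------------------
-- Generated sub-permutations

-- The biggest block of consecutive entries around k with all entries ≥ k:
-- split π just before k and extend to either side until an entry < k is met.
-- (For a permutation of size < k, which has no entry k, this is [].)
s : ℕ → List ℕ → List ℕ
s k π = let before , from-k = break (k ℕ.≟_) π in
  reverse (takeWhile (k ℕ.≤?_) (reverse before)) ++ takeWhile (k ℕ.≤?_) from-k

rescale : List ℕ → List ℕ
rescale xs = map (λ x → length (filter (ℕ._≤? x) xs)) xs

g : ℕ → List ℕ → List ℕ
g k π = rescale (s k π)

_∈Av[_؛_] : List ℕ → List ℕ → ℕ → Set
π ∈Av[ σ ؛ k ] = (¬ (σ ≺ π)) ⇔ (¬ (σ ≺ g k π))

_∈Av?[_؛_] : ∀ π σ k → Dec (π ∈Av[ σ ؛ k ])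
π ∈Av?[ σ ؛ k ] = ¬? (σ ≺? π) ⇔-dec ¬? (σ ≺? g k π)

-- The probability that a uniformly random permutation of size n satisfies P.
Prob : ∀ {P : Pred (List ℕ) p} → ℕ → Decidable P → ℚ
Prob n P? = (+ length (filter P? (𝒮 n)) / length (𝒮 n)) {{∣𝒮∣≢0 n}}

Prob[∉Av] : List ℕ → ℕ → ℕ → ℚ
Prob[∉Av] σ k n = Prob n (λ π → ¬? (π ∈Av?[ σ ؛ k ]))

-- ∑_{i=1}^{N} |Av_i(σ)| / (i-1)!
partialSum : List ℕ → ℕ → ℚ
partialSum σ zero    = 0ℚ
partialSum σ (suc N) = partialSum σ N ℚ.+ (+ (∣Av suc N ∣ σ) / (N !)) {{N ℕ.!≢0}}

2/_² : ∀ n .{{_ : NonZero n}} → ℚ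
2/ n ² = (+ 2 / (n ^ 2)) {{ℕ.m^n≢0 n 2}}

------------------------------------------------------------------------
-- Real numbers, as Cauchy sequences of rationals

Cauchy : (ℕ → ℚ) → Set
Cauchy x = ∀ ε → 0ℚ ℚ.< ε →
  ∃[ N ] (∀ m n → N ≤ m → N ≤ n → ℚ.∣ x m ℚ.- x n ∣ ℚ.≤ ε)

record ℝ : Set where
  constructor mkℝ
  field
    seq    : ℕ → ℚ
    cauchy : Cauchy seq

open ℝ public

_≤ʳ_ : ℝ → ℝ → Set
x ≤ʳ y = ∀ ε → 0ℚ ℚ.< ε → ∃[ N ] (∀ n → N ≤ n → seq x n ℚ.≤ seq y n ℚ.+ ε)

fromℚ : ℚ → ℝ
fromℚ q = mkℝ (λ _ → q) λ ε 0<ε → 0 , λ _ _ _ _ →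
  subst (ℚ._≤ ε) (sym (cong ℚ.∣_∣ (ℚ.+-inverseʳ q))) (ℚ.<⇒≤ 0<ε)

private
  module _ where
    open import Data.Rational.Solver using (module +-*-Solver)
    open +-*-Solver

    sub-interchange : ∀ a b c d → (a ℚ.- b) ℚ.- (c ℚ.- d) ≡ (a ℚ.- c) ℚ.- (b ℚ.- d)
    sub-interchange = solve 4 (λ a b c d → (a :- b) :- (c :- d) := (a :- c) :- (b :- d)) refl

    *-distribˡ-sub : ∀ q a b → q ℚ.* a ℚ.- q ℚ.* b ≡ q ℚ.* (a ℚ.- b)
    *-distribˡ-sub = solve 3 (λ q a b → q :* a :- q :* b := q :* (a :- b)) refl

    cancel-sub : ∀ a b → (a ℚ.- b) ℚ.+ b ≡ a
    cancel-sub = solve 2 (λ a b → (a :- b) :+ b := a) refl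

    add-sub : ∀ a b → (a ℚ.+ b) ℚ.- b ≡ a
    add-sub = solve 2 (λ a b → (a :+ b) :- b := a) refl

    neg-sub : ∀ a b → ℚ.- (a ℚ.- b) ≡ b ℚ.- a
    neg-sub = solve 2 (λ a b → :- (a :- b) := b :- a) refl

    halves : ∀ a → ½ ℚ.* a ℚ.+ ½ ℚ.* a ≡ a
    halves a = trans (sym (ℚ.*-distribʳ-+ a ½ ½)) (ℚ.*-identityˡ a)

  half-pos : ∀ {ε} → 0ℚ ℚ.< ε → 0ℚ ℚ.< ½ ℚ.* ε
  half-pos {ε} 0<ε = subst (ℚ._< ½ ℚ.* ε) (ℚ.*-zeroʳ ½) (ℚ.*-monoʳ-<-pos ½ 0<ε)

  ∣a∣-∣b∣≤∣a-b∣ : ∀ a b → ℚ.∣ a ∣ ℚ.- ℚ.∣ b ∣ ℚ.≤ ℚ.∣ a ℚ.- b ∣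
  ∣a∣-∣b∣≤∣a-b∣ a b = begin
    ℚ.∣ a ∣ ℚ.- ℚ.∣ b ∣                       ≡⟨ cong (λ t → ℚ.∣ t ∣ ℚ.- ℚ.∣ b ∣) (cancel-sub a b) ⟨
    ℚ.∣ (a ℚ.- b) ℚ.+ b ∣ ℚ.- ℚ.∣ b ∣         ≤⟨ ℚ.+-monoˡ-≤ (ℚ.- ℚ.∣ b ∣) (ℚ.∣p+q∣≤∣p∣+∣q∣ (a ℚ.- b) b) ⟩
    (ℚ.∣ a ℚ.- b ∣ ℚ.+ ℚ.∣ b ∣) ℚ.- ℚ.∣ b ∣   ≡⟨ add-sub ℚ.∣ a ℚ.- b ∣ ℚ.∣ b ∣ ⟩
    ℚ.∣ a ℚ.- b ∣                             ∎
    where open ℚ.≤-Reasoning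

  ∣∣a∣-∣b∣∣≤∣a-b∣ : ∀ a b → ℚ.∣ ℚ.∣ a ∣ ℚ.- ℚ.∣ b ∣ ∣ ℚ.≤ ℚ.∣ a ℚ.- b ∣
  ∣∣a∣-∣b∣∣≤∣a-b∣ a b with ℚ.∣p∣≡p∨∣p∣≡-p (ℚ.∣ a ∣ ℚ.- ℚ.∣ b ∣)
  ... | inj₁ eq = subst (ℚ._≤ ℚ.∣ a ℚ.- b ∣) (sym eq) (∣a∣-∣b∣≤∣a-b∣ a b)
  ... | inj₂ eq = begin
    ℚ.∣ ℚ.∣ a ∣ ℚ.- ℚ.∣ b ∣ ∣   ≡⟨ eq ⟩
    ℚ.- (ℚ.∣ a ∣ ℚ.- ℚ.∣ b ∣)   ≡⟨ neg-sub ℚ.∣ a ∣ ℚ.∣ b ∣ ⟩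
    ℚ.∣ b ∣ ℚ.- ℚ.∣ a ∣         ≤⟨ ∣a∣-∣b∣≤∣a-b∣ b a ⟩
    ℚ.∣ b ℚ.- a ∣               ≡⟨ cong ℚ.∣_∣ (neg-sub a b) ⟨
    ℚ.∣ ℚ.- (a ℚ.- b) ∣         ≡⟨ ℚ.∣-p∣≡∣p∣ (a ℚ.- b) ⟩
    ℚ.∣ a ℚ.- b ∣               ∎
    where open ℚ.≤-Reasoning

_-ʳ_ : ℝ → ℝ → ℝ
x -ʳ y = mkℝ (λ n → seq x n ℚ.- seq y n) λ ε 0<ε →
  let M , x-cauchy = cauchy x (½ ℚ.* ε) (half-pos 0<ε)
      N , y-cauchy = cauchy y (½ ℚ.* ε) (half-pos 0<ε)
  in M ⊔ N , λ m n ≤m ≤n → begin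
    ℚ.∣ (seq x m ℚ.- seq y m) ℚ.- (seq x n ℚ.- seq y n) ∣
      ≡⟨ cong ℚ.∣_∣ (sub-interchange (seq x m) (seq y m) (seq x n) (seq y n)) ⟩
    ℚ.∣ (seq x m ℚ.- seq x n) ℚ.- (seq y m ℚ.- seq y n) ∣
      ≤⟨ ℚ.∣p-q∣≤∣p∣+∣q∣ (seq x m ℚ.- seq x n) (seq y m ℚ.- seq y n) ⟩
    ℚ.∣ seq x m ℚ.- seq x n ∣ ℚ.+ ℚ.∣ seq y m ℚ.- seq y n ∣
      ≤⟨ ℚ.+-mono-≤
           (x-cauchy m n (ℕ.m⊔n≤o⇒m≤o M N ≤m) (ℕ.m⊔n≤o⇒m≤o M N ≤n))
           (y-cauchy m n (ℕ.m⊔n≤o⇒n≤o M N ≤m) (ℕ.m⊔n≤o⇒n≤o M N ≤n)) ⟩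
    ½ ℚ.* ε ℚ.+ ½ ℚ.* ε
      ≡⟨ halves ε ⟩
    ε ∎
  where open ℚ.≤-Reasoning

∣_∣ʳ : ℝ → ℝ
∣ x ∣ʳ = mkℝ (λ n → ℚ.∣ seq x n ∣) λ ε 0<ε →
  let N , x-cauchy = cauchy x ε 0<ε
  in N , λ m n ≤m ≤n → ℚ.≤-trans (∣∣a∣-∣b∣∣≤∣a-b∣ (seq x m) (seq x n)) (x-cauchy m n ≤m ≤n)

_·ʳ_ : ℚ → ℝ → ℝ
q ·ʳ x = mkℝ (λ n → q ℚ.* seq x n) λ ε 0<ε →
  let ε′ = (ℚ.1/ c) ℚ.* ε
      N , x-cauchy = cauchy x ε′
        (subst (ℚ._< ε′) (ℚ.*-zeroʳ (ℚ.1/ c)) (ℚ.*-monoʳ-<-pos (ℚ.1/ c) 0<ε))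
  in N , λ m n ≤m ≤n → begin
    ℚ.∣ q ℚ.* seq x m ℚ.- q ℚ.* seq x n ∣  ≡⟨ cong ℚ.∣_∣ (*-distribˡ-sub q (seq x m) (seq x n)) ⟩
    ℚ.∣ q ℚ.* (seq x m ℚ.- seq x n) ∣      ≡⟨ ℚ.∣p*q∣≡∣p∣*∣q∣ q (seq x m ℚ.- seq x n) ⟩
    ℚ.∣ q ∣ ℚ.* ℚ.∣ seq x m ℚ.- seq x n ∣  ≤⟨ ℚ.*-monoʳ-≤-nonNeg _ {{ℚ.∣-∣-nonNeg (seq x m ℚ.- seq x n)}} ∣q∣≤c ⟩
    c ℚ.* ℚ.∣ seq x m ℚ.- seq x n ∣        ≤⟨ ℚ.*-monoˡ-≤-nonNeg c {{ℚ.pos⇒nonNeg c}} (x-cauchy m n ≤m ≤n) ⟩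
    c ℚ.* ε′                               ≡⟨ ℚ.*-assoc c (ℚ.1/ c) ε ⟨
    c ℚ.* ℚ.1/ c ℚ.* ε                     ≡⟨ cong (ℚ._* ε) (ℚ.*-inverseʳ c) ⟩
    1ℚ ℚ.* ε                               ≡⟨ ℚ.*-identityˡ ε ⟩
    ε                                      ∎
  where
  open ℚ.≤-Reasoning
  c = ℚ.∣ q ∣ ℚ.+ 1ℚ
  instance
    c-pos : ℚ.Positive c
    c-pos = ℚ.nonNeg+pos⇒pos ℚ.∣ q ∣ {{ℚ.∣-∣-nonNeg q}} 1ℚ
    c≢0 : ℚ.NonZero c
    c≢0 = ℚ.pos⇒nonZero c
    1/c-pos : ℚ.Positive (ℚ.1/ c)
    1/c-pos = ℚ.1/pos⇒pos c
  ∣q∣≤c : ℚ.∣ q ∣ ℚ.≤ c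
  ∣q∣≤c = subst (ℚ._≤ c) (ℚ.+-identityʳ ℚ.∣ q ∣) (ℚ.+-monoʳ-≤ ℚ.∣ q ∣ {0ℚ} {1ℚ} (ℚ.nonNegative⁻¹ 1ℚ))

------------------------------------------------------------------------
-- Limits and asymptotics. Tolerances ε range over the positive rationals,
-- which is equivalent to all positive reals since every positive real has a
-- positive rational below it.

_⟶_ : (ℕ → ℝ) → ℝ → Set
x ⟶ L = ∀ ε → 0ℚ ℚ.< ε → ∃[ N ] (∀ n → N ≤ n → ∣ x n -ʳ L ∣ʳ ≤ʳ fromℚ ε)

-- Sequences indexed by n ≥ 1.
Seq⁺ : Set
Seq⁺ = ∀ n .{{_ : NonZero n}} → ℝ

LittleO : Seq⁺ → Seq⁺ → Set
LittleO u v = ∀ ε → 0ℚ ℚ.< ε →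
  ∃[ N ] (∀ n .{{_ : NonZero n}} → N ≤ n → ∣ u n ∣ʳ ≤ʳ ε ·ʳ ∣ v n ∣ʳ)

_∼_ : Seq⁺ → Seq⁺ → Set
u ∼ v = LittleO (λ n → u n -ʳ v n) v

{-# OPTIONS --safe #-}

-- Write a permutation of size n ≥ 2 as π = α 1 β. Then s_π(2) is the one of α, β that contains 2, so
-- choosing the set of its entries, its order (avoiding σ) and the order of the rest shows that
-- 2 (n-2)! ∑_{i<n} |Av_i(σ)|/(i-1)! permutations have g_π(2) avoiding σ. Since g_π(2) ≺ π, the ones
-- outside Av_n(σ;2) are these minus the |Av_n(σ)| permutations that avoid σ.
-- Cutting a permutation after m entries gives p_{m+n} ≤ p_m p_n for p_n = |Av_n(σ)|/n!, and
-- p_{|σ|} < 1. Hence p_n decays geometrically; the weaker n³ p_n = O(1) already makes the tail of the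
-- series from N on O(1/N) and n² p_n → 0, without the Stanley-Wilf theorem.
module Submission where

open import Defs
open import Data.Nat.Base hiding (_/_)
open import Data.Nat.Properties
open import Data.Nat.Induction using (<-rec)
open import Data.Nat.ListAction using (sum)
open import Data.Nat.ListAction.Properties using (sum-↭)
open import Data.Nat.Solver using (module +-*-Solver)
open import Algebra.Properties.CommutativeSemigroup +-commutativeSemigroup using (interchange)
import Data.Integer.Base as ℤ
import Data.Integer.Properties as ℤ
open import Data.Rational.Base as ℚ using (ℚ; mkℚ; 0ℚ; 1ℚ; _/_; ↧ₙ_; toℚᵘ)
import Data.Rational.Properties as ℚ
import Data.Rational.Solver as ℚSolver
import Data.Rational.Unnormalised.Base as ℚᵘ
import Data.Rational.Unnormalised.Properties as ℚᵘ
open import Data.List.Base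
  using (List; []; _∷_; _++_; length; map; filter; zip; reverse; take; drop; takeWhile; break;
         concatMap; applyUpTo)
open import Data.List.Properties
  using (map-id; map-∘; map-cong; map-++; map-concatMap; concatMap-map; concatMap-cong; ∷-injective;
         length-applyUpTo; length-map; length-++; length-take; length-filter; filter-notAll;
         ++-identityʳ; ++-assoc; take++drop≡id; reverse-++; reverse-involutive; unfold-reverse;
         span-defn; takeWhile++dropWhile)
open import Data.List.Membership.Propositional using (_∈_; _∉_; lose)
open import Data.List.Membership.Propositional.Properties
open import Data.List.Membership.Propositional.Properties.WithK using (unique∧set⇒bag)
open import Data.List.Relation.Binary.BagAndSetEquality using (∼bag⇒↭)
open import Data.List.Relation.Unary.Any using (here; there)
open import Data.List.Relation.Unary.All as All using (All; []; _∷_)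
import Data.List.Relation.Unary.All.Properties as All
open import Data.List.Relation.Unary.AllPairs as AllPairs using (AllPairs; []; _∷_)
import Data.List.Relation.Unary.AllPairs.Properties as AllPairs
open import Data.List.Relation.Unary.Unique.Propositional using (Unique)
open import Data.List.Relation.Unary.Unique.DecPropositional _≟_ using (unique?)
import Data.List.Relation.Unary.Unique.Propositional.Properties as Unique
open import Data.List.Relation.Binary.Permutation.Propositional
  using (_↭_; ↭-refl; ↭-sym; ↭-trans; prep; ↭⇒↭ₛ)
open import Data.List.Relation.Binary.Permutation.Propositional.Properties
  using (drop-mid; shift; map⁺; ∈-resp-↭; All-resp-↭; ↭-empty-inv; ↭-length; ↭-reverse)
import Data.List.Relation.Binary.Permutation.Setoid.Properties as Permutationₛ
open import Data.List.Relation.Binary.Sublist.Propositional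
  using (_⊆_; []; _∷_; _∷ʳ_; ⊆-refl; ⊆-reflexive; ⊆-trans; minimum)
open import Data.List.Relation.Binary.Sublist.Propositional.Properties
  using (All-resp-⊆; length-mono-≤; ++⁺; take-⊆; drop-⊆; takeWhile-⊆; reverse⁺)
open import Data.Product.Base using (_×_; _,_; proj₁; proj₂; map₁; map₂; ∃-syntax; uncurry; swap)
open import Data.Sum.Base using (inj₁; inj₂)
open import Data.Empty using (⊥-elim)
open import Function.Base using (_∘_; id)
open import Function.Bundles using (mk⇔; _⇔_)
open import Function.Construct.Composition using (_⇔-∘_)
open import Function.Construct.Symmetry using (⇔-sym)
open import Level using (Level)
open import Relation.Nullary using (yes; no; ¬_)
open import Relation.Nullary.Decidable using (¬?; Dec)
open import Relation.Unary using (Pred; Decidable)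
open import Relation.Binary.Core using (Rel)
open import Relation.Binary.Definitions using (Symmetric)
open import Relation.Binary.PropositionalEquality

-- The relation to be proved bounds a relative error, so every error has to be small compared with
-- h. For |σ| ≥ 2 this is harmless, since h ≥ |Av_1(σ)| = 1. For |σ| ≤ 1 all terms of the series
-- vanish, h = 0, and the probability has to be exactly 0. The single constraint `C ≤ C * ∣Av 1 ∣ σ`
-- on the constant of the cubic bound covers both cases. The exponent 3 comes from the denominators
-- (i-1)!: the terms of the series are i p_i, so n³ p_n ≤ C bounds them by C/i², which a telescoping
-- majorant sums. With n = k + 2 and H for the partial sums, the probability is (2 k! H(k+1) -
-- |Av_n(σ)|)/n!. It deviates from 2h/n² through n(n-1) in place of n², through the tail of the
-- series and through |Av_n(σ)|; each costs a relative error O(1/n). The counting stays in ℕ with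
-- factorials multiplied out, and one identity, `∑-perms-cuts`, serves both ways of dividing a
-- permutation: at the entry 1 and after m entries.

private variable
  ℓ ℓ′ : Level
  A : Set ℓ
  B : Set ℓ′

-- Sums over lists

∑ : List A → (A → ℕ) → ℕ
∑ xs f = sum (map f xs)

∑-cong : ∀ (xs : List A) {f h : A → ℕ} → (∀ {x} → x ∈ xs → f x ≡ h x) → ∑ xs f ≡ ∑ xs h
∑-cong []       f≡h = refl
∑-cong (x ∷ xs) f≡h = cong₂ _+_ (f≡h (here refl)) (∑-cong xs (f≡h ∘ there))

∑-mono : ∀ (xs : List A) {f h : A → ℕ} → (∀ {x} → x ∈ xs → f x ≤ h x) → ∑ xs f ≤ ∑ xs h
∑-mono []       f≤h = z≤n
∑-mono (x ∷ xs) f≤h = +-mono-≤ (f≤h (here refl)) (∑-mono xs (f≤h ∘ there))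

∑-mono-< : ∀ {xs : List A} {f h : A → ℕ} {y} → y ∈ xs → f y < h y → (∀ x → f x ≤ h x) → ∑ xs f < ∑ xs h
∑-mono-< {xs = _ ∷ xs} (here refl) f<h f≤h = +-mono-<-≤ f<h (∑-mono xs (λ _ → f≤h _))
∑-mono-< {xs = x ∷ _}  (there y∈)  f<h f≤h = +-mono-≤-< (f≤h x) (∑-mono-< y∈ f<h f≤h)

∈⇒≤∑ : ∀ (f : A → ℕ) {x} {xs : List A} → x ∈ xs → f x ≤ ∑ xs f
∈⇒≤∑ f (here refl) = m≤m+n _ _
∈⇒≤∑ f {xs = y ∷ xs} (there x∈xs) = ≤-trans (∈⇒≤∑ f x∈xs) (m≤n+m _ (f y))

∑-const : ∀ (xs : List A) c → ∑ xs (λ _ → c) ≡ length xs * c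
∑-const []       c = refl
∑-const (x ∷ xs) c = cong (c +_) (∑-const xs c)

∑-zero : ∀ (xs : List A) → ∑ xs (λ _ → 0) ≡ 0
∑-zero []       = refl
∑-zero (_ ∷ xs) = ∑-zero xs

length≡∑ : ∀ (xs : List A) → length xs ≡ ∑ xs (λ _ → 1)
length≡∑ xs = trans (sym (*-identityʳ _)) (sym (∑-const xs 1))

∑-+ : ∀ (xs : List A) (f h : A → ℕ) → ∑ xs (λ x → f x + h x) ≡ ∑ xs f + ∑ xs h
∑-+ []       f h = refl
∑-+ (x ∷ xs) f h = trans (cong (f x + h x +_) (∑-+ xs f h)) (interchange (f x) (h x) _ _)

∑-*ˡ : ∀ c (xs : List A) (f : A → ℕ) → ∑ xs (λ x → c * f x) ≡ c * ∑ xs f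
∑-*ˡ c []       f = sym (*-zeroʳ c)
∑-*ˡ c (x ∷ xs) f = trans (cong (c * f x +_) (∑-*ˡ c xs f)) (sym (*-distribˡ-+ c (f x) _))

∑-*ʳ : ∀ c (xs : List A) (f : A → ℕ) → ∑ xs (λ x → f x * c) ≡ ∑ xs f * c
∑-*ʳ c xs f = trans (∑-cong xs (λ {x} _ → *-comm (f x) c)) (trans (∑-*ˡ c xs f) (*-comm c _))

∑-map : ∀ (h : A → B) xs (f : B → ℕ) → ∑ (map h xs) f ≡ ∑ xs (f ∘ h)
∑-map h xs f = cong sum (sym (map-∘ xs))

∑-++ : ∀ (xs ys : List A) (f : A → ℕ) → ∑ (xs ++ ys) f ≡ ∑ xs f + ∑ ys f
∑-++ []       ys f = refl
∑-++ (x ∷ xs) ys f = trans (cong (f x +_) (∑-++ xs ys f)) (sym (+-assoc (f x) _ _))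

∑-concatMap : ∀ (h : A → List B) xs (f : B → ℕ) →
  ∑ (concatMap h xs) f ≡ ∑ xs (λ x → ∑ (h x) f)
∑-concatMap h []       f = refl
∑-concatMap h (x ∷ xs) f = trans (∑-++ (h x) _ f) (cong (∑ (h x) f +_) (∑-concatMap h xs f))

∑-swap : ∀ (xs : List A) (ys : List B) (f : A → B → ℕ) →
  ∑ xs (λ x → ∑ ys (f x)) ≡ ∑ ys (λ y → ∑ xs (λ x → f x y))
∑-swap []       ys f = sym (∑-zero ys)
∑-swap (x ∷ xs) ys f = trans (cong (∑ ys (f x) +_) (∑-swap xs ys f))
                             (sym (∑-+ ys (f x) (λ y → ∑ xs (λ x → f x y))))

∑-↭ : ∀ {xs ys : List A} (f : A → ℕ) → xs ↭ ys → ∑ xs f ≡ ∑ ys f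
∑-↭ f xs↭ys = sum-↭ (map⁺ f xs↭ys)

[_]? : Dec B → ℕ
[ yes _ ]? = 1
[ no _ ]?  = 0

length-filter≡∑ : ∀ {P : Pred A ℓ′} (P? : Decidable P) xs → length (filter P? xs) ≡ ∑ xs (λ x → [ P? x ]?)
length-filter≡∑ P? []       = refl
length-filter≡∑ P? (x ∷ xs) with P? x
... | yes _ = cong suc (length-filter≡∑ P? xs)
... | no _  = length-filter≡∑ P? xs

[]?-mono : ∀ {C : Set ℓ} {D : Set ℓ′} (c? : Dec C) (d? : Dec D) → (C → D) → [ c? ]? ≤ [ d? ]?
[]?-mono (no _)  d?       f = z≤n
[]?-mono (yes _) (yes _)  f = ≤-refl
[]?-mono (yes c) (no ¬d)  f = ⊥-elim (¬d (f c))

-- Cuts, splits and permutations of a list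

cuts : List A → List (List A × List A)
cuts []       = ([] , []) ∷ []
cuts (x ∷ xs) = ([] , x ∷ xs) ∷ map (map₁ (x ∷_)) (cuts xs)

glue : A → List A × List A → List A
glue x (α , β) = α ++ x ∷ β

insertions : A → List A → List (List A)
insertions x xs = map (glue x) (cuts xs)

-- The head is inserted last, so for `[1⋯ n ]` the outermost insertion is that of the entry 1. This
-- yields the form α 1 β directly.
perms : List A → List (List A)
perms []       = [] ∷ []
perms (x ∷ xs) = concatMap (insertions x) (perms xs)

splits : List A → List (List A × List A)
splits []       = ([] , []) ∷ []
splits (x ∷ xs) = map (map₁ (x ∷_)) (splits xs) ++ map (map₂ (x ∷_)) (splits xs)

∑-cuts-∷ : ∀ x (xs : List A) f →
  ∑ (cuts (x ∷ xs)) f ≡ f ([] , x ∷ xs) + ∑ (cuts xs) (f ∘ map₁ (x ∷_))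
∑-cuts-∷ x xs f = cong (f ([] , x ∷ xs) +_) (∑-map (map₁ (x ∷_)) (cuts xs) f)

∑-insertions-∷ : ∀ x y (xs : List A) f →
  ∑ (insertions x (y ∷ xs)) f ≡ f (x ∷ y ∷ xs) + ∑ (insertions x xs) (f ∘ (y ∷_))
∑-insertions-∷ x y xs f = begin
  ∑ (insertions x (y ∷ xs)) f                                          ≡⟨ ∑-map (glue x) (cuts (y ∷ xs)) f ⟩
  ∑ (cuts (y ∷ xs)) (f ∘ glue x)                                       ≡⟨ ∑-cuts-∷ y xs (f ∘ glue x) ⟩
  f (x ∷ y ∷ xs) + ∑ (cuts xs) (f ∘ (y ∷_) ∘ glue x)                   ≡⟨ cong (f (x ∷ y ∷ xs) +_) (∑-map (glue x) (cuts xs) (f ∘ (y ∷_))) ⟨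
  f (x ∷ y ∷ xs) + ∑ (insertions x xs) (f ∘ (y ∷_))                    ∎
  where open ≡-Reasoning

∑-splits-∷ : ∀ x (xs : List A) f →
  ∑ (splits (x ∷ xs)) f ≡ ∑ (splits xs) (f ∘ map₁ (x ∷_)) + ∑ (splits xs) (f ∘ map₂ (x ∷_))
∑-splits-∷ x xs f = trans (∑-++ (map (map₁ (x ∷_)) (splits xs)) _ f)
  (cong₂ _+_ (∑-map _ (splits xs) f) (∑-map _ (splits xs) f))

∑-perms-∷ : ∀ x (xs : List A) f → ∑ (perms (x ∷ xs)) f ≡ ∑ (perms xs) (λ π → ∑ (insertions x π) f)
∑-perms-∷ x xs f = ∑-concatMap (insertions x) (perms xs) f

insertˡ insertʳ : A → (List A × List A → ℕ) → List A × List A → ℕ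
insertˡ x f (α , β) = ∑ (insertions x α) (λ α′ → f (α′ , β))
insertʳ x f (α , β) = ∑ (insertions x β) (λ β′ → f (α , β′))

-- In a cut of a word into which x was inserted, x lies in the left or in the right part. Deleting
-- it leaves a cut of xs, and putting it back anywhere in the same part recovers all such cuts.
∑-insertions-cuts : ∀ x (xs : List A) f →
  ∑ (insertions x xs) (λ π → ∑ (cuts π) f) ≡
  ∑ (cuts xs) (insertˡ x f) + ∑ (cuts xs) (insertʳ x f)
∑-insertions-cuts x [] f =
  solve 2 (λ u v → (u :+ (v :+ con 0)) :+ con 0 := ((v :+ con 0) :+ con 0) :+ ((u :+ con 0) :+ con 0)) refl
    (f ([] , x ∷ [])) (f (x ∷ [] , []))
  where open +-*-Solver
∑-insertions-cuts x (y ∷ xs) f = begin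
  ∑ (insertions x (y ∷ xs)) (λ π → ∑ (cuts π) f)
    ≡⟨ ∑-insertions-∷ x y xs _ ⟩
  ∑ (cuts (x ∷ y ∷ xs)) f + ∑ (insertions x xs) (λ π → ∑ (cuts (y ∷ π)) f)
    ≡⟨ cong₂ _+_
         (trans (∑-cuts-∷ x (y ∷ xs) f) (cong (f ([] , x ∷ y ∷ xs) +_) (∑-cuts-∷ y xs _)))
         (trans (∑-cong (insertions x xs) (λ {π} _ → ∑-cuts-∷ y π f)) (∑-+ (insertions x xs) _ _)) ⟩
  p + (q + r) + (s₁ + ∑ (insertions x xs) (λ π → ∑ (cuts π) (f ∘ map₁ (y ∷_))))
    ≡⟨ cong (λ t → p + (q + r) + (s₁ + t)) (∑-insertions-cuts x xs (f ∘ map₁ (y ∷_))) ⟩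
  p + (q + r) + (s₁ + (u + v))
    -- `p + s₁` collects the cuts with an empty left part, and `q` is the one whose left part is x
    -- alone.
    ≡⟨ solve 6 (λ p q r s₁ u v → p :+ (q :+ r) :+ (s₁ :+ (u :+ v)) :=
         ((q :+ con 0) :+ (r :+ u)) :+ ((p :+ s₁) :+ v)) refl p q r s₁ u v ⟩
  (q + 0 + (r + u)) + ((p + s₁) + v)
    ≡⟨ cong₂ (λ t t′ → (q + 0 + t) + (t′ + v))
         (trans (∑-cong (cuts xs) (λ {(α , β)} _ → ∑-insertions-∷ x y α _)) (∑-+ (cuts xs) _ _))
         (∑-insertions-∷ x y xs _) ⟨
  (q + 0 + ∑ (cuts xs) (λ (α , β) → ∑ (insertions x (y ∷ α)) (λ α′ → f (α′ , β))))
    + (∑ (insertions x (y ∷ xs)) (λ β′ → f ([] , β′)) + v)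
    ≡⟨ cong₂ _+_ (∑-cuts-∷ y xs (insertˡ x f)) (∑-cuts-∷ y xs (insertʳ x f)) ⟨
  ∑ (cuts (y ∷ xs)) (insertˡ x f) + ∑ (cuts (y ∷ xs)) (insertʳ x f) ∎
  where
  open ≡-Reasoning
  open +-*-Solver
  p = f ([] , x ∷ y ∷ xs)
  q = f (x ∷ [] , y ∷ xs)
  r = ∑ (cuts xs) (λ (α , β) → f (x ∷ y ∷ α , β))
  s₁ = ∑ (insertions x xs) (λ π → f ([] , y ∷ π))
  u = ∑ (cuts xs) (λ (α , β) → ∑ (insertions x α) (λ α′ → f (y ∷ α′ , β)))
  v = ∑ (cuts xs) (λ (α , β) → ∑ (insertions x β) (λ β′ → f (y ∷ α , β′)))

-- Both sides run over the pairs (α , β) for which α ++ β is a permutation of xs.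
∑-perms-cuts : ∀ (xs : List A) f →
  ∑ (perms xs) (λ π → ∑ (cuts π) f) ≡
  ∑ (splits xs) (λ (X , Y) → ∑ (perms X) (λ α → ∑ (perms Y) (λ β → f (α , β))))
∑-perms-cuts []       f = cong (_+ 0) (sym (+-identityʳ _))
∑-perms-cuts (x ∷ xs) f = begin
  ∑ (perms (x ∷ xs)) (λ π → ∑ (cuts π) f)
    ≡⟨ ∑-perms-∷ x xs _ ⟩
  ∑ (perms xs) (λ π → ∑ (insertions x π) (λ π′ → ∑ (cuts π′) f))
    ≡⟨ ∑-cong (perms xs) (λ {π} _ → ∑-insertions-cuts x π f) ⟩
  ∑ (perms xs) (λ π → ∑ (cuts π) (insertˡ x f) + ∑ (cuts π) (insertʳ x f))
    ≡⟨ ∑-+ (perms xs) _ _ ⟩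
  ∑ (perms xs) (λ π → ∑ (cuts π) (insertˡ x f))
    + ∑ (perms xs) (λ π → ∑ (cuts π) (insertʳ x f))
    ≡⟨ cong₂ _+_ (∑-perms-cuts xs _) (∑-perms-cuts xs _) ⟩
  ∑ (splits xs) (λ (X , Y) → ∑ (perms X) (λ α → ∑ (perms Y) (λ β → ∑ (insertions x α) (λ α′ → f (α′ , β)))))
    + ∑ (splits xs) (λ (X , Y) → ∑ (perms X) (λ α → ∑ (perms Y) (λ β → ∑ (insertions x β) (λ β′ → f (α , β′)))))
    ≡⟨ cong₂ _+_
         (∑-cong (splits xs) (λ {(X , Y)} _ → trans
           (∑-cong (perms X) (λ {α} _ → ∑-swap (perms Y) (insertions x α) _))
           (sym (∑-perms-∷ x X _))))
         (∑-cong (splits xs) (λ {(X , Y)} _ →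
           ∑-cong (perms X) (λ {α} _ → sym (∑-perms-∷ x Y _)))) ⟩
  ∑ (splits xs) (λ (X , Y) → ∑ (perms (x ∷ X)) (λ α → ∑ (perms Y) (λ β → f (α , β))))
    + ∑ (splits xs) (λ (X , Y) → ∑ (perms X) (λ α → ∑ (perms (x ∷ Y)) (λ β → f (α , β))))
    ≡⟨ ∑-splits-∷ x xs _ ⟨
  ∑ (splits (x ∷ xs)) (λ (X , Y) → ∑ (perms X) (λ α → ∑ (perms Y) (λ β → f (α , β)))) ∎
  where open ≡-Reasoning

∈-cuts⁺ : ∀ (α β : List A) → (α , β) ∈ cuts (α ++ β)
∈-cuts⁺ []      []      = here refl
∈-cuts⁺ []      (y ∷ β) = here refl
∈-cuts⁺ (x ∷ α) β       = there (∈-map⁺ (map₁ (x ∷_)) (∈-cuts⁺ α β))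

∈-cuts⁻ : ∀ (xs : List A) {α β} → (α , β) ∈ cuts xs → α ++ β ≡ xs
∈-cuts⁻ []       (here refl) = refl
∈-cuts⁻ (x ∷ xs) (here refl) = refl
∈-cuts⁻ (x ∷ xs) (there c∈) with _ , c∈′ , refl ← ∈-map⁻ (map₁ (x ∷_)) c∈ = cong (x ∷_) (∈-cuts⁻ xs c∈′)

∈-insertions⁻ : ∀ {x : A} {xs π} → π ∈ insertions x xs → ∃[ α ] ∃[ β ] (π ≡ α ++ x ∷ β × α ++ β ≡ xs)
∈-insertions⁻ {x = x} {xs} π∈ with (α , β) , c∈ , refl ← ∈-map⁻ (glue x) π∈ = α , β , refl , ∈-cuts⁻ xs c∈

∈-perms⁻ : ∀ (xs : List A) {π} → π ∈ perms xs → π ↭ xs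
∈-perms⁻ []       (here refl) = ↭-refl
∈-perms⁻ (x ∷ xs) π∈
  with π′ , π∈ins , π′∈ ← ∈-concat⁻′ (map (insertions x) (perms xs)) π∈
  with ρ , ρ∈ , refl ← ∈-map⁻ (insertions x) π′∈
  with α , β , refl , refl ← ∈-insertions⁻ π∈ins
  = ↭-trans (shift x α β) (prep x (∈-perms⁻ xs ρ∈))

∈-perms⁺ : ∀ (xs : List A) {π} → π ↭ xs → π ∈ perms xs
∈-perms⁺ []       π↭ with refl ← ↭-empty-inv π↭ = here refl
∈-perms⁺ (x ∷ xs) π↭ with α , β , refl ← ∈-∃++ (∈-resp-↭ (↭-sym π↭) (here refl)) =
  ∈-concat⁺′ (∈-map⁺ (glue x) (∈-cuts⁺ α β))
             (∈-map⁺ (insertions x) (∈-perms⁺ xs (drop-mid α [] π↭)))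

length-perms-∈ : ∀ (xs : List A) {π} → π ∈ perms xs → length π ≡ length xs
length-perms-∈ xs = ↭-length ∘ ∈-perms⁻ xs

-- Injectivity is asked for on the members of xs only, because `glue x` is injective just on cuts of
-- words without x.
unique-map : ∀ (f : A → B) {xs} → (∀ {x y} → x ∈ xs → y ∈ xs → f x ≡ f y → x ≡ y) →
             Unique xs → Unique (map f xs)
unique-map f inj []            = []
unique-map f inj (x∉xs ∷ xs!) =
  All.tabulate (λ fy∈ fx≡ → let y , y∈ , fy≡ = ∈-map⁻ f fy∈ in
    All.lookup x∉xs y∈ (inj (here refl) (there y∈) (trans fx≡ fy≡)))
  ∷ unique-map f (λ x∈ y∈ → inj (there x∈) (there y∈)) xs!

unique-concatMap : ∀ (f : A → List B) {xs} → (∀ {x} → x ∈ xs → Unique (f x)) →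
  (∀ {x y z} → x ∈ xs → y ∈ xs → z ∈ f x → z ∈ f y → x ≡ y) → Unique xs → Unique (concatMap f xs)
unique-concatMap f f! disj []           = []
unique-concatMap f {x ∷ xs} f! disj (x∉xs ∷ xs!) = Unique.++⁺ (f! (here refl))
  (unique-concatMap f (f! ∘ there) (λ x∈ y∈ → disj (there x∈) (there y∈)) xs!)
  λ (z∈ , z∈′) → let fy , z∈fy , fy∈ = ∈-concat⁻′ (map f xs) z∈′
                     y , y∈ , fy≡ = ∈-map⁻ f fy∈
                 in All.lookup x∉xs y∈ (disj (here refl) (there y∈) z∈ (subst (_ ∈_) fy≡ z∈fy))

unique-cuts : ∀ (xs : List A) → Unique (cuts xs)
unique-cuts []       = [] ∷ []
unique-cuts {A = A} (x ∷ xs) =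
  All.tabulate (λ c∈ → head∉ (∈-map⁻ (map₁ (x ∷_)) c∈))
  ∷ Unique.map⁺ map₁-inj (unique-cuts xs)
  where
  head∉ : ∀ {c} → ∃[ c′ ] (c′ ∈ cuts xs × c ≡ map₁ (x ∷_) c′) → ([] , x ∷ xs) ≢ c
  head∉ (_ , _ , refl) ()
  map₁-inj : ∀ {c c′ : List A × List A} → map₁ (x ∷_) c ≡ map₁ (x ∷_) c′ → c ≡ c′
  map₁-inj refl = refl

-- The displayed x is the first occurrence of x on either side, and this locates the cut.
glue-injective : ∀ {x : A} α α′ {β β′} → x ∉ α → x ∉ α′ →
  α ++ x ∷ β ≡ α′ ++ x ∷ β′ → (α , β) ≡ (α′ , β′)
glue-injective []      []        x∉ x∉′ refl = refl
glue-injective []      (y ∷ α′)  x∉ x∉′ refl = ⊥-elim (x∉′ (here refl))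
glue-injective (y ∷ α) []        x∉ x∉′ refl = ⊥-elim (x∉ (here refl))
glue-injective (y ∷ α) (y′ ∷ α′) x∉ x∉′ eq with refl , eq′ ← ∷-injective eq =
  cong (map₁ (y ∷_)) (glue-injective α α′ (x∉ ∘ there) (x∉′ ∘ there) eq′)

unique-perms : ∀ {xs : List A} → Unique xs → Unique (perms xs)
unique-perms []                       = [] ∷ []
unique-perms {A = A} {xs = x ∷ xs} (x≢ ∷ xs!) = unique-concatMap (insertions x)
  (λ {π} π∈ → unique-map (glue x)
    (λ {(α , _)} {(α′ , _)} c∈ c∈′ → glue-injective α α′ (x∉ π∈ (∈-cuts⁻ π c∈)) (x∉ π∈ (∈-cuts⁻ π c∈′)))
    (unique-cuts π))
  (λ π∈ ρ∈ z∈ z∈′ → disjoint π∈ ρ∈ (∈-insertions⁻ z∈) (∈-insertions⁻ z∈′))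
  (unique-perms xs!)
  where
  x∉ : ∀ {π α β} → π ∈ perms xs → α ++ β ≡ π → x ∉ α
  x∉ π∈ refl x∈α = All.lookup x≢ (∈-resp-↭ (∈-perms⁻ xs π∈) (∈-++⁺ˡ x∈α)) refl
  disjoint : ∀ {π ρ z} → π ∈ perms xs → ρ ∈ perms xs →
    ∃[ α ] ∃[ β ] (z ≡ α ++ x ∷ β × α ++ β ≡ π) → ∃[ α ] ∃[ β ] (z ≡ α ++ x ∷ β × α ++ β ≡ ρ) → π ≡ ρ
  disjoint π∈ ρ∈ (α , β , z≡ , refl) (α′ , β′ , z≡′ , refl)
    with refl ← glue-injective α α′ (x∉ π∈ refl) (x∉ ρ∈ refl) (trans (sym z≡) z≡′) = refl

-- The members of `𝒮 n` as the permutations of `[1⋯ n ]`, and their number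

∈-words⁻ : ∀ (as : List A) m {w} → w ∈ words as m → length w ≡ m × All (_∈ as) w
∈-words⁻ as zero    (here refl) = refl , []
∈-words⁻ as (suc m) w∈ with a , w′ , a∈ , w′∈ , refl ← ∈-cartesianProductWith⁻ _∷_ as (words as m) w∈ =
  let len , all = ∈-words⁻ as m w′∈ in cong suc len , a∈ ∷ all

unique-words : ∀ {as : List A} m → Unique as → Unique (words as m)
unique-words zero    as! = [] ∷ []
unique-words (suc m) as! = Unique.cartesianProductWith⁺ _∷_ ∷-injective as! (unique-words m as!)

unique∧⊆⇒↭ : ∀ {xs ys : List A} → Unique xs → All (_∈ ys) xs → ∃[ zs ] (ys ↭ xs ++ zs)
unique∧⊆⇒↭ {ys = ys} [] [] = ys , ↭-refl
unique∧⊆⇒↭ {xs = x ∷ xs} {ys} (x≢ ∷ xs!) (x∈ ∷ xs⊆) with α , β , refl ← ∈-∃++ x∈ =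
  let zs , eq = unique∧⊆⇒↭ xs! (All.tabulate remove)
  in zs , ↭-trans (shift x α β) (prep x eq)
  where
  remove : ∀ {y} → y ∈ xs → y ∈ α ++ β
  remove y∈ with ∈-resp-↭ (shift x α β) (All.lookup xs⊆ y∈)
  ... | here refl = ⊥-elim (All.lookup x≢ y∈ refl)
  ... | there y∈′ = y∈′

unique-[1⋯_] : ∀ n → Unique [1⋯ n ]
unique-[1⋯ n ] = Unique.applyUpTo⁺₁ suc n (λ i<j _ eq → <⇒≢ i<j (suc-injective eq))

Unique-resp-↭ : ∀ {xs ys : List A} → xs ↭ ys → Unique xs → Unique ys
Unique-resp-↭ xs↭ys = Permutationₛ.AllPairs-resp-↭ (setoid _) (λ x≢y → x≢y ∘ sym) ((λ where refl p → p) , (λ where refl p → p)) (↭⇒↭ₛ xs↭ys)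

-- A word without repetitions can be taken out of `[1⋯ n ]` entry by entry; as its length is n,
-- nothing is left over.
∈𝒮⇒↭ : ∀ n {π} → π ∈ 𝒮 n → π ↭ [1⋯ n ]
∈𝒮⇒↭ n {π} π∈ with w∈ , π! ← ∈-filter⁻ unique? {xs = words [1⋯ n ] n} π∈ with len , π⊆ ← ∈-words⁻ [1⋯ n ] n w∈
  with zs , eq ← unique∧⊆⇒↭ π! π⊆ with zs
... | []     = ↭-sym (subst ([1⋯ n ] ↭_) (++-identityʳ π) eq)
... | z ∷ zs = ⊥-elim (m≢1+m+n n (begin
  n                                  ≡⟨ length-applyUpTo suc n ⟨
  length [1⋯ n ]                     ≡⟨ ↭-length eq ⟩
  length (π ++ z ∷ zs)               ≡⟨ length-++ π ⟩
  length π + suc (length zs)         ≡⟨ cong (_+ suc (length zs)) len ⟩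
  n + suc (length zs)                ≡⟨ +-suc n _ ⟩
  suc (n + length zs)                ∎))
  where
  open ≡-Reasoning

↭⇒∈𝒮 : ∀ n {π} → π ↭ [1⋯ n ] → π ∈ 𝒮 n
↭⇒∈𝒮 n {π} π↭ = ∈-filter⁺ unique?
  (subst (λ l → π ∈ words [1⋯ n ] l) (trans (↭-length π↭) (length-applyUpTo suc n))
    (∈-words (All.tabulate (∈-resp-↭ π↭))))
  (Unique-resp-↭ (↭-sym π↭) unique-[1⋯ n ])

-- This trades the filtered list of words for the recursive `perms`, over which sums can be
-- rearranged. Both lists are free of repetitions, so equal membership suffices.
𝒮↭perms : ∀ n → 𝒮 n ↭ perms [1⋯ n ]
𝒮↭perms n = ∼bag⇒↭ (unique∧set⇒bag
  (Unique.filter⁺ unique? (unique-words n unique-[1⋯ n ]))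
  (unique-perms unique-[1⋯ n ])
  (mk⇔ (∈-perms⁺ _ ∘ ∈𝒮⇒↭ n) (↭⇒∈𝒮 n ∘ ∈-perms⁻ _)))

count-𝒮 : ∀ {ℓ} {P : Pred (List ℕ) ℓ} (P? : Decidable P) n →
  length (filter P? (𝒮 n)) ≡ ∑ (perms [1⋯ n ]) (λ π → [ P? π ]?)
count-𝒮 P? n = trans (length-filter≡∑ P? (𝒮 n)) (∑-↭ _ (𝒮↭perms n))

length-cuts : ∀ (xs : List A) → length (cuts xs) ≡ suc (length xs)
length-cuts []       = refl
length-cuts (x ∷ xs) = cong suc (trans (length-map _ (cuts xs)) (length-cuts xs))

length-insertions : ∀ (x : A) xs → length (insertions x xs) ≡ suc (length xs)
length-insertions x xs = trans (length-map _ (cuts xs)) (length-cuts xs)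

length-perms : ∀ (xs : List A) → length (perms xs) ≡ length xs !
length-perms []       = refl
length-perms (x ∷ xs) = begin
  length (perms (x ∷ xs))                                 ≡⟨ length≡∑ (perms (x ∷ xs)) ⟩
  ∑ (perms (x ∷ xs)) (λ _ → 1)                            ≡⟨ ∑-perms-∷ x xs _ ⟩
  ∑ (perms xs) (λ π → ∑ (insertions x π) (λ _ → 1))       ≡⟨ ∑-cong (perms xs) (λ {π} π∈ → begin
      ∑ (insertions x π) (λ _ → 1)    ≡⟨ length≡∑ (insertions x π) ⟨
      length (insertions x π)         ≡⟨ length-insertions x π ⟩
      suc (length π)                  ≡⟨ cong suc (length-perms-∈ xs π∈) ⟩
      suc (length xs)                 ≡⟨ *-identityʳ _ ⟨
      suc (length xs) * 1             ∎) ⟩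
  ∑ (perms xs) (λ _ → suc (length xs) * 1)                ≡⟨ ∑-*ˡ (suc (length xs)) (perms xs) (λ _ → 1) ⟩
  suc (length xs) * ∑ (perms xs) (λ _ → 1)                ≡⟨ cong (suc (length xs) *_) (length≡∑ (perms xs)) ⟨
  suc (length xs) * length (perms xs)                     ≡⟨ cong (suc (length xs) *_) (length-perms xs) ⟩
  suc (length xs) !                                       ∎
  where open ≡-Reasoning

length-𝒮 : ∀ n → length (𝒮 n) ≡ n !
length-𝒮 n = begin
  length (𝒮 n)             ≡⟨ ↭-length (𝒮↭perms n) ⟩
  length (perms [1⋯ n ])   ≡⟨ length-perms [1⋯ n ] ⟩
  length [1⋯ n ] !         ≡⟨ cong _! (length-applyUpTo suc n) ⟩
  n !                      ∎
  where open ≡-Reasoning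

-- Pattern containment and order isomorphism

AllPairs-resp-⊆ : ∀ {R : Rel A ℓ′} {xs ys} → xs ⊆ ys → AllPairs R ys → AllPairs R xs
AllPairs-resp-⊆ []          []         = []
AllPairs-resp-⊆ (_ ∷ʳ xs⊆)  (_ ∷ ps)   = AllPairs-resp-⊆ xs⊆ ps
AllPairs-resp-⊆ (refl ∷ xs⊆) (p ∷ ps)  = All-resp-⊆ xs⊆ p ∷ AllPairs-resp-⊆ xs⊆ ps

AllPairs-tabulate : ∀ {R : Rel A ℓ′} (xs : List A) → (∀ {x y} → x ∈ xs → y ∈ xs → R x y) → AllPairs R xs
AllPairs-tabulate []       r = []
AllPairs-tabulate (x ∷ xs) r =
  All.tabulate (r (here refl) ∘ there) ∷ AllPairs-tabulate xs (λ x∈ y∈ → r (there x∈) (there y∈))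

SameOrder-sym : Symmetric SameOrder
SameOrder-sym (p , q) = q , p

iso-sym : ∀ {xs ys} → OrderIsomorphic xs ys → OrderIsomorphic ys xs
iso-sym {xs} {ys} (len , so) = sym len , go xs ys so
  where
  go₁ : ∀ {x y} xs ys → All (SameOrder (x , y)) (zip xs ys) → All (SameOrder (y , x)) (zip ys xs)
  go₁ []       []       []             = []
  go₁ []       (_ ∷ _)  []             = []
  go₁ (_ ∷ _)  []       []             = []
  go₁ (x ∷ xs) (y ∷ ys) ((p , q) ∷ ps) = (⇔-sym p , ⇔-sym q) ∷ go₁ xs ys ps
  go : ∀ xs ys → AllPairs SameOrder (zip xs ys) → AllPairs SameOrder (zip ys xs)
  go []       []       []       = []
  go []       (_ ∷ _)  []       = []
  go (_ ∷ _)  []       []       = []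
  go (x ∷ xs) (y ∷ ys) (p ∷ ps) = go₁ xs ys p ∷ go xs ys ps

iso-trans : ∀ {xs ys zs} → OrderIsomorphic xs ys → OrderIsomorphic ys zs → OrderIsomorphic xs zs
iso-trans {xs} {ys} {zs} (len , so) (len′ , so′) = trans len len′ , go xs ys zs len so so′
  where
  go₁ : ∀ {x y z} xs ys zs → length xs ≡ length ys → All (SameOrder (x , y)) (zip xs ys) →
        All (SameOrder (y , z)) (zip ys zs) → All (SameOrder (x , z)) (zip xs zs)
  go₁ []       _        _        len []             _                = []
  go₁ (_ ∷ _)  (_ ∷ _)  []       len _              _                = []
  go₁ (x ∷ xs) (y ∷ ys) (z ∷ zs) len ((p , q) ∷ ps) ((p′ , q′) ∷ ps′) =
    (p′ ⇔-∘ p , q′ ⇔-∘ q) ∷ go₁ xs ys zs (suc-injective len) ps ps′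
  go : ∀ xs ys zs → length xs ≡ length ys → AllPairs SameOrder (zip xs ys) →
       AllPairs SameOrder (zip ys zs) → AllPairs SameOrder (zip xs zs)
  go []       _        _        len _        _          = []
  go (_ ∷ _)  (_ ∷ _)  []       len _        _          = []
  go (x ∷ xs) (y ∷ ys) (z ∷ zs) len (p ∷ ps) (p′ ∷ ps′) =
    go₁ xs ys zs (suc-injective len) p p′ ∷ go xs ys zs (suc-injective len) ps ps′

-- τ′ is read off ys at the positions of τ. The inclusion of the zips lets the subsequences inherit
-- `SameOrder` from the whole words.
matching-sublist : ∀ {τ} {xs : List A} (ys : List B) → length xs ≡ length ys → τ ⊆ xs →
  ∃[ τ′ ] (τ′ ⊆ ys × length τ ≡ length τ′ × zip τ τ′ ⊆ zip xs ys)
matching-sublist []       len []          = [] , [] , refl , []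
matching-sublist (y ∷ ys) len (x ∷ʳ τ⊆)   =
  let τ′ , τ′⊆ , len′ , z⊆ = matching-sublist ys (suc-injective len) τ⊆ in τ′ , y ∷ʳ τ′⊆ , len′ , _ ∷ʳ z⊆
matching-sublist (y ∷ ys) len (refl ∷ τ⊆) =
  let τ′ , τ′⊆ , len′ , z⊆ = matching-sublist ys (suc-injective len) τ⊆ in y ∷ τ′ , refl ∷ τ′⊆ , cong suc len′ , refl ∷ z⊆

≺-resp-iso : ∀ {σ xs ys} → OrderIsomorphic xs ys → σ ≺ xs → σ ≺ ys
≺-resp-iso {ys = ys} (len , so) (τ , τ⊆ , iso) =
  let τ′ , τ′⊆ , len′ , z⊆ = matching-sublist ys len τ⊆
  in τ′ , τ′⊆ , iso-trans (iso-sym (len′ , AllPairs-resp-⊆ z⊆ so)) iso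

≺-resp-⊆ : ∀ {σ xs ys} → xs ⊆ ys → σ ≺ xs → σ ≺ ys
≺-resp-⊆ xs⊆ys (τ , τ⊆ , iso) = τ , ⊆-trans τ⊆ xs⊆ys , iso

zip-map : ∀ {ℓ″} {C : Set ℓ″} (f : A → B) (h : A → C) zs → zip (map f zs) (map h zs) ≡ map (λ z → f z , h z) zs
zip-map f h []       = refl
zip-map f h (z ∷ zs) = cong (_ ∷_) (zip-map f h zs)

map-iso : ∀ (f h : A → ℕ) {zs} → AllPairs (λ x y → SameOrder (f x , h x) (f y , h y)) zs →
          OrderIsomorphic (map f zs) (map h zs)
map-iso f h {zs} so = trans (length-map f zs) (sym (length-map h zs)) ,
  subst (AllPairs SameOrder) (sym (zip-map f h zs)) (AllPairs.map⁺ so)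

map-proj₁-zip : ∀ (xs : List A) (ys : List B) → length xs ≡ length ys → map proj₁ (zip xs ys) ≡ xs
map-proj₁-zip []       []       len = refl
map-proj₁-zip (x ∷ xs) (y ∷ ys) len = cong (x ∷_) (map-proj₁-zip xs ys (suc-injective len))

map-proj₂-zip : ∀ (xs : List A) (ys : List B) → length xs ≡ length ys → map proj₂ (zip xs ys) ≡ ys
map-proj₂-zip []       []       len = refl
map-proj₂-zip (x ∷ xs) (y ∷ ys) len = cong (y ∷_) (map-proj₂-zip xs ys (suc-injective len))

-- Rescaling

module _ (xs : List ℕ) where

  rank : ℕ → ℕ
  rank x = length (filter (_≤? x) xs)

  private
    rank≡∑ : ∀ x → rank x ≡ ∑ xs (λ z → [ z ≤? x ]?)
    rank≡∑ x = length-filter≡∑ (_≤? x) xs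

    ≤-indicator : ∀ {x y} → x ≤ y → ∀ z → [ z ≤? x ]? ≤ [ z ≤? y ]?
    ≤-indicator {x} {y} x≤y z = []?-mono (z ≤? x) (z ≤? y) (λ z≤x → ≤-trans z≤x x≤y)

    <-indicator : ∀ {x y} → x < y → [ y ≤? x ]? < [ y ≤? y ]?
    <-indicator {x} {y} x<y with y ≤? x | y ≤? y
    ... | yes y≤x | _      = ⊥-elim (<⇒≱ x<y y≤x)
    ... | no _    | yes _  = ≤-refl
    ... | no _    | no y≰y = ⊥-elim (y≰y ≤-refl)

  rank-mono-≤ : ∀ {x y} → x ≤ y → rank x ≤ rank y
  rank-mono-≤ {x} {y} x≤y = subst₂ _≤_ (sym (rank≡∑ x)) (sym (rank≡∑ y)) (∑-mono xs (λ {z} _ → ≤-indicator x≤y z))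

  rank-mono-< : ∀ {x y} → y ∈ xs → x < y → rank x < rank y
  rank-mono-< {x} {y} y∈ x<y =
    subst₂ _<_ (sym (rank≡∑ x)) (sym (rank≡∑ y)) (∑-mono-< y∈ (<-indicator x<y) (≤-indicator (<⇒≤ x<y)))

  rank-< : ∀ {x y} → y ∈ xs → x < y ⇔ rank x < rank y
  rank-< y∈ = mk⇔ (rank-mono-< y∈) (λ r<r → ≰⇒> (λ y≤x → <⇒≱ r<r (rank-mono-≤ y≤x)))

-- `rescale xs` is the image of xs under `rank xs`, which is strictly increasing on the entries of
-- xs: the larger of two entries counts itself, the smaller does not count it.
iso-rescale : ∀ xs → OrderIsomorphic xs (rescale xs)
iso-rescale xs = subst (λ ys → OrderIsomorphic ys (rescale xs)) (map-id xs)
  (map-iso id (rank xs) (AllPairs-tabulate xs (λ x∈ y∈ → rank-< xs y∈ , rank-< xs x∈)))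

-- The number of permutations of a list that avoid σ

cuts-map : ∀ (f : A → B) xs → cuts (map f xs) ≡ map (λ (α , β) → map f α , map f β) (cuts xs)
cuts-map f []       = refl
cuts-map f (x ∷ xs) = cong (([] , f x ∷ map f xs) ∷_) (begin
  map (map₁ (f x ∷_)) (cuts (map f xs))     ≡⟨ cong (map _) (cuts-map f xs) ⟩
  map (map₁ (f x ∷_)) (map _ (cuts xs))     ≡⟨ map-∘ (cuts xs) ⟨
  map _ (cuts xs)                           ≡⟨ map-∘ (cuts xs) ⟩
  map _ (map (map₁ (x ∷_)) (cuts xs))       ∎)
  where open ≡-Reasoning

insertions-map : ∀ (f : A → B) x xs → insertions (f x) (map f xs) ≡ map (map f) (insertions x xs)
insertions-map f x xs = begin
  map (glue (f x)) (cuts (map f xs))    ≡⟨ cong (map _) (cuts-map f xs) ⟩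
  map (glue (f x)) (map _ (cuts xs))    ≡⟨ map-∘ (cuts xs) ⟨
  map _ (cuts xs)                       ≡⟨ map-cong (λ (α , β) → sym (map-++ f α (x ∷ β))) (cuts xs) ⟩
  map _ (cuts xs)                       ≡⟨ map-∘ (cuts xs) ⟩
  map (map f) (insertions x xs)         ∎
  where open ≡-Reasoning

-- Naturality: `perms` moves positions and ignores the entries. Applied to a list of pairs, it
-- permutes two words in parallel.
perms-map : ∀ (f : A → B) xs → perms (map f xs) ≡ map (map f) (perms xs)
perms-map f []       = refl
perms-map f (x ∷ xs) = begin
  concatMap (insertions (f x)) (perms (map f xs))           ≡⟨ cong (concatMap _) (perms-map f xs) ⟩
  concatMap (insertions (f x)) (map (map f) (perms xs))     ≡⟨ concatMap-map _ (map f) (perms xs) ⟩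
  concatMap (insertions (f x) ∘ map f) (perms xs)           ≡⟨ concatMap-cong (insertions-map f x) (perms xs) ⟩
  concatMap (map (map f) ∘ insertions x) (perms xs)         ≡⟨ map-concatMap (map f) (insertions x) (perms xs) ⟨
  map (map f) (perms (x ∷ xs))                              ∎
  where open ≡-Reasoning

avoids : List ℕ → List ℕ → ℕ
avoids σ π = [ ¬? (σ ≺? π) ]?

avoids-antimono : ∀ σ xs ys → (σ ≺ ys → σ ≺ xs) → avoids σ xs ≤ avoids σ ys
avoids-antimono σ xs ys f = []?-mono (¬? (σ ≺? xs)) (¬? (σ ≺? ys)) (_∘ f)

avoids-iso : ∀ σ {xs ys} → OrderIsomorphic xs ys → avoids σ xs ≡ avoids σ ys
avoids-iso σ {xs} {ys} iso = ≤-antisym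
  (avoids-antimono σ xs ys (≺-resp-iso (iso-sym iso))) (avoids-antimono σ ys xs (≺-resp-iso iso))

-- Both words are projections of their zip, so by naturality they are permuted together. `SameOrder`
-- is symmetric, hence survives any rearrangement of the pairs, and the projections of each permuted
-- zip are again isomorphic.
∑-perms-iso : ∀ σ {xs ys} → OrderIsomorphic xs ys → ∑ (perms xs) (avoids σ) ≡ ∑ (perms ys) (avoids σ)
∑-perms-iso σ {xs} {ys} (len , so) = begin
  ∑ (perms xs) (avoids σ)                          ≡⟨ cong (λ l → ∑ (perms l) (avoids σ)) (map-proj₁-zip xs ys len) ⟨
  ∑ (perms (map proj₁ zs)) (avoids σ)              ≡⟨ cong (λ l → ∑ l (avoids σ)) (perms-map proj₁ zs) ⟩
  ∑ (map (map proj₁) (perms zs)) (avoids σ)        ≡⟨ ∑-map (map proj₁) (perms zs) (avoids σ) ⟩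
  ∑ (perms zs) (avoids σ ∘ map proj₁)              ≡⟨ ∑-cong (perms zs) (λ ρ∈ → avoids-iso σ (map-iso proj₁ proj₂ (
                                                        Permutationₛ.AllPairs-resp-↭ (setoid _) SameOrder-sym
                                                          ((λ where refl p → p) , (λ where refl p → p))
                                                          (↭⇒↭ₛ (↭-sym (∈-perms⁻ zs ρ∈))) so))) ⟩
  ∑ (perms zs) (avoids σ ∘ map proj₂)              ≡⟨ ∑-map (map proj₂) (perms zs) (avoids σ) ⟨
  ∑ (map (map proj₂) (perms zs)) (avoids σ)        ≡⟨ cong (λ l → ∑ l (avoids σ)) (perms-map proj₂ zs) ⟨
  ∑ (perms (map proj₂ zs)) (avoids σ)              ≡⟨ cong (λ l → ∑ (perms l) (avoids σ)) (map-proj₂-zip xs ys len) ⟩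
  ∑ (perms ys) (avoids σ)                          ∎
  where
  open ≡-Reasoning
  zs = zip xs ys

Increasing : List ℕ → Set
Increasing = AllPairs _<_

increasing-iso : ∀ {xs ys} → length xs ≡ length ys → Increasing xs → Increasing ys → OrderIsomorphic xs ys
increasing-iso len xs↑ ys↑ = len , go xs↑ ys↑
  where
  both : ∀ {x y x′ y′} → x < x′ → y < y′ → SameOrder (x , y) (x′ , y′)
  both x< y< = mk⇔ (λ _ → y<) (λ _ → x<) , mk⇔ (⊥-elim ∘ <-asym x<) (⊥-elim ∘ <-asym y<)
  go₁ : ∀ {x y xs ys} → All (x <_) xs → All (y <_) ys → All (SameOrder (x , y)) (zip xs ys)
  go₁ []       _        = []
  go₁ (_ ∷ _)  []       = []
  go₁ (p ∷ ps) (q ∷ qs) = both p q ∷ go₁ ps qs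
  go : ∀ {xs ys} → Increasing xs → Increasing ys → AllPairs SameOrder (zip xs ys)
  go []       _        = []
  go (_ ∷ _)  []       = []
  go (p ∷ ps) (q ∷ qs) = go₁ p q ∷ go ps qs

increasing-[1⋯_] : ∀ n → Increasing [1⋯ n ]
increasing-[1⋯ n ] = AllPairs.applyUpTo⁺₁ suc n (λ i<j _ → s≤s i<j)

∣Av∣≡∑ : ∀ σ n → ∣Av n ∣ σ ≡ ∑ (perms [1⋯ n ]) (avoids σ)
∣Av∣≡∑ σ n = count-𝒮 (λ π → ¬? (σ ≺? π)) n

-- A set of entries, listed increasingly, is isomorphic to an initial segment, so only its size
-- matters for the number of avoiding arrangements.
∑-perms-avoids : ∀ σ {xs} → Increasing xs → ∑ (perms xs) (avoids σ) ≡ ∣Av length xs ∣ σ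
∑-perms-avoids σ {xs} xs↑ = trans
  (∑-perms-iso σ (increasing-iso (sym (length-applyUpTo suc (length xs))) xs↑ increasing-[1⋯ length xs ]))
  (sym (∣Av∣≡∑ σ (length xs)))

∈-splits⁻ : ∀ (xs : List A) {X Y} → (X , Y) ∈ splits xs → X ⊆ xs × Y ⊆ xs
∈-splits⁻ []       (here refl) = [] , []
∈-splits⁻ (x ∷ xs) s∈ with ∈-++⁻ (map (map₁ (x ∷_)) (splits xs)) s∈
... | inj₁ s∈ˡ with _ , s∈′ , refl ← ∈-map⁻ (map₁ (x ∷_)) s∈ˡ =
  let X⊆ , Y⊆ = ∈-splits⁻ xs s∈′ in refl ∷ X⊆ , x ∷ʳ Y⊆
... | inj₂ s∈ʳ with _ , s∈′ , refl ← ∈-map⁻ (map₂ (x ∷_)) s∈ʳ =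
  let X⊆ , Y⊆ = ∈-splits⁻ xs s∈′ in x ∷ʳ X⊆ , refl ∷ Y⊆

-- The block around an entry

takeWhile-stops : ∀ {P : Pred A ℓ′} (P? : Decidable P) {xs y ys} → All P xs → ¬ P y →
                  takeWhile P? (xs ++ y ∷ ys) ≡ xs
takeWhile-stops P? {[]} {y} [] ¬py with P? y
... | yes py = ⊥-elim (¬py py)
... | no _   = refl
takeWhile-stops P? {x ∷ xs} (px ∷ pxs) ¬py with P? x
... | yes _  = cong (x ∷_) (takeWhile-stops P? pxs ¬py)
... | no ¬px = ⊥-elim (¬px px)

takeWhile-all : ∀ {P : Pred A ℓ′} (P? : Decidable P) {xs} → All P xs → takeWhile P? xs ≡ xs
takeWhile-all P? []               = refl
takeWhile-all P? (_∷_ {x} px pxs) with P? x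
... | yes _  = cong (x ∷_) (takeWhile-all P? pxs)
... | no ¬px = ⊥-elim (¬px px)

break-stops : ∀ {P : Pred A ℓ′} (P? : Decidable P) {xs y ys} → All (¬_ ∘ P) xs → P y →
              break P? (xs ++ y ∷ ys) ≡ (xs , y ∷ ys)
break-stops P? {[]} {y} [] py with P? y
... | yes _  = refl
... | no ¬py = ⊥-elim (¬py py)
break-stops P? {x ∷ xs} (¬px ∷ ¬pxs) py with P? x
... | yes px = ⊥-elim (¬px px)
... | no _   = cong (map₁ (x ∷_)) (break-stops P? ¬pxs py)

first-occurrence : ∀ {k xs} → k ∈ xs → ∃[ ys ] ∃[ zs ] (xs ≡ ys ++ k ∷ zs × k ∉ ys)
first-occurrence {k} {x ∷ xs} k∈ with k ≟ x
... | yes refl = [] , xs , refl , λ ()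
first-occurrence (here refl) | no k≢x = ⊥-elim (k≢x refl)
first-occurrence (there k∈)  | no k≢x with ys , zs , refl , k∉ ← first-occurrence k∈ =
  _ ∷ ys , zs , refl , λ { (here refl) → k≢x refl ; (there k∈) → k∉ k∈ }

s-at : ∀ k {xs ys} → k ∉ xs → s k (xs ++ k ∷ ys) ≡
       reverse (takeWhile (k ≤?_) (reverse xs)) ++ takeWhile (k ≤?_) (k ∷ ys)
s-at k {xs} {ys} k∉ = cong (λ (b , f) → reverse (takeWhile (k ≤?_) (reverse b)) ++ takeWhile (k ≤?_) f)
                 (break-stops (k ≟_) (All.¬Any⇒All¬ xs k∉) refl)

reverse-reverse-all : ∀ k {xs} → All (k ≤_) xs → reverse (takeWhile (k ≤?_) (reverse xs)) ≡ xs
reverse-reverse-all k {xs} k≤ = trans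
  (cong reverse (takeWhile-all (k ≤?_) (All-resp-↭ (↭-sym (↭-reverse xs)) k≤)))
  (reverse-involutive xs)

-- The block reaches the left end of the word because α has no entry below k, and x stops it on the
-- right.
s-left : ∀ {k x α β} → x < k → k ∈ α → All (k ≤_) α → s k (α ++ x ∷ β) ≡ α
s-left {k} {x} {α} {β} x<k k∈α k≤α with α₁ , α₂ , refl , k∉ ← first-occurrence k∈α = begin
  s k ((α₁ ++ k ∷ α₂) ++ x ∷ β)                ≡⟨ cong (s k) (++-assoc α₁ (k ∷ α₂) (x ∷ β)) ⟩
  s k (α₁ ++ k ∷ α₂ ++ x ∷ β)                  ≡⟨ s-at k k∉ ⟩
  reverse (takeWhile (k ≤?_) (reverse α₁)) ++ takeWhile (k ≤?_) ((k ∷ α₂) ++ x ∷ β)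
                                               ≡⟨ cong₂ _++_ (reverse-reverse-all k (All.++⁻ˡ α₁ k≤α))
                                                    (takeWhile-stops (k ≤?_) (All.++⁻ʳ α₁ k≤α) (<⇒≱ x<k)) ⟩
  α₁ ++ k ∷ α₂                                 ∎
  where open ≡-Reasoning

s-right : ∀ {k x α β} → x < k → k ∉ α → k ∈ β → All (k ≤_) β → s k (α ++ x ∷ β) ≡ β
s-right {k} {x} {α} {β} x<k k∉α k∈β k≤β with β₁ , β₂ , refl , k∉ ← first-occurrence k∈β = begin
  s k (α ++ x ∷ β₁ ++ k ∷ β₂)                  ≡⟨ cong (s k) (++-assoc α (x ∷ β₁) (k ∷ β₂)) ⟨
  s k ((α ++ x ∷ β₁) ++ k ∷ β₂)                ≡⟨ s-at k k∉′ ⟩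
  reverse (takeWhile (k ≤?_) (reverse (α ++ x ∷ β₁))) ++ takeWhile (k ≤?_) (k ∷ β₂)
                                               ≡⟨ cong₂ _++_ left (takeWhile-all (k ≤?_) (All.++⁻ʳ β₁ k≤β)) ⟩
  β₁ ++ k ∷ β₂                                 ∎
  where
  open ≡-Reasoning
  k∉′ : k ∉ α ++ x ∷ β₁
  k∉′ k∈ with ∈-++⁻ α k∈
  ... | inj₁ k∈α          = k∉α k∈α
  ... | inj₂ (here refl)  = <-irrefl refl x<k
  ... | inj₂ (there k∈β₁) = k∉ k∈β₁
  -- The search to the left of k reads the reversed prefix, so it passes all of β₁ before x stops
  -- it.
  reverse-split : reverse (α ++ x ∷ β₁) ≡ reverse β₁ ++ x ∷ reverse α
  reverse-split = begin
    reverse (α ++ x ∷ β₁)                  ≡⟨ reverse-++ α (x ∷ β₁) ⟩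
    reverse (x ∷ β₁) ++ reverse α          ≡⟨ cong (_++ reverse α) (unfold-reverse x β₁) ⟩
    (reverse β₁ ++ x ∷ []) ++ reverse α    ≡⟨ ++-assoc (reverse β₁) (x ∷ []) (reverse α) ⟩
    reverse β₁ ++ x ∷ reverse α            ∎
  left : reverse (takeWhile (k ≤?_) (reverse (α ++ x ∷ β₁))) ≡ β₁
  left = begin
    reverse (takeWhile (k ≤?_) (reverse (α ++ x ∷ β₁)))
      ≡⟨ cong (reverse ∘ takeWhile (k ≤?_)) reverse-split ⟩
    reverse (takeWhile (k ≤?_) (reverse β₁ ++ x ∷ reverse α))
      ≡⟨ cong reverse (takeWhile-stops (k ≤?_) (All-resp-↭ (↭-sym (↭-reverse β₁)) (All.++⁻ˡ β₁ k≤β)) (<⇒≱ x<k)) ⟩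
    reverse (reverse β₁)
      ≡⟨ reverse-involutive β₁ ⟩
    β₁ ∎

-- Sums over the pairs (i , j) with i + j = n

antidiagonal-∑ : ℕ → (ℕ → ℕ → ℕ) → ℕ
antidiagonal-∑ zero    c = c 0 0
antidiagonal-∑ (suc n) c = antidiagonal-∑ n (λ i j → c i (suc j)) + c (suc n) 0

antidiagonal-∑-cong : ∀ n {c d : ℕ → ℕ → ℕ} → (∀ i j → i + j ≡ n → c i j ≡ d i j) →
                      antidiagonal-∑ n c ≡ antidiagonal-∑ n d
antidiagonal-∑-cong zero    c≡d = c≡d 0 0 refl
antidiagonal-∑-cong (suc n) c≡d = cong₂ _+_
  (antidiagonal-∑-cong n (λ i j eq → c≡d i (suc j) (trans (+-suc i j) (cong suc eq))))
  (c≡d (suc n) 0 (+-identityʳ (suc n)))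

antidiagonal-∑-+ : ∀ n (c d : ℕ → ℕ → ℕ) →
  antidiagonal-∑ n (λ i j → c i j + d i j) ≡ antidiagonal-∑ n c + antidiagonal-∑ n d
antidiagonal-∑-+ zero    c d = refl
antidiagonal-∑-+ (suc n) c d =
  trans (cong (_+ (c (suc n) 0 + d (suc n) 0)) (antidiagonal-∑-+ n _ _))
        (interchange (antidiagonal-∑ n (λ i j → c i (suc j))) _ _ _)

antidiagonal-∑-zero : ∀ n → antidiagonal-∑ n (λ _ _ → 0) ≡ 0
antidiagonal-∑-zero zero    = refl
antidiagonal-∑-zero (suc n) = cong (_+ 0) (antidiagonal-∑-zero n)

antidiagonal-∑-suc : ∀ n (c : ℕ → ℕ → ℕ) →
  antidiagonal-∑ (suc n) c ≡ c 0 (suc n) + antidiagonal-∑ n (λ i j → c (suc i) j)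
antidiagonal-∑-suc zero    c = refl
antidiagonal-∑-suc (suc n) c = trans
  (cong (_+ c (suc (suc n)) 0) (antidiagonal-∑-suc n (λ i j → c i (suc j))))
  (+-assoc (c 0 (suc (suc n))) _ _)

-- The Kronecker delta, defined by simultaneous recursion so that shifting both arguments is
-- definitional.
δ : ℕ → ℕ → ℕ
δ zero    zero    = 1
δ zero    (suc n) = 0
δ (suc m) zero    = 0
δ (suc m) (suc n) = δ m n

δ-refl : ∀ n → δ n n ≡ 1
δ-refl zero    = refl
δ-refl (suc n) = δ-refl n

antidiagonal-∑-δ : ∀ m n (c : ℕ → ℕ → ℕ) → antidiagonal-∑ (m + n) (λ i j → δ i m * c i j) ≡ c m n
antidiagonal-∑-δ zero    zero    c = +-identityʳ _
antidiagonal-∑-δ zero    (suc n) c = begin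
  antidiagonal-∑ (suc n) (λ i j → δ i 0 * c i j)                   ≡⟨ antidiagonal-∑-suc n (λ i j → δ i 0 * c i j) ⟩
  c 0 (suc n) + 0 + antidiagonal-∑ n (λ _ _ → 0)                   ≡⟨ cong₂ _+_ (+-identityʳ _) (antidiagonal-∑-zero n) ⟩
  c 0 (suc n) + 0                                                  ≡⟨ +-identityʳ _ ⟩
  c 0 (suc n)                                                      ∎
  where open ≡-Reasoning
antidiagonal-∑-δ (suc m) n       c = trans (antidiagonal-∑-suc (m + n) (λ i j → δ i (suc m) * c i j)) (antidiagonal-∑-δ m n (λ i j → c (suc i) j))

-- binomial i j is the binomial coefficient (i + j) over i.
binomial : ℕ → ℕ → ℕ
binomial zero    j       = 1
binomial (suc i) zero    = 1
binomial (suc i) (suc j) = binomial i (suc j) + binomial (suc i) j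

binomial-zeroʳ : ∀ i → binomial i 0 ≡ 1
binomial-zeroʳ zero    = refl
binomial-zeroʳ (suc i) = refl

-- The factorial formula without division. In Pascal's rule the two summands leave the factors i + 1
-- and j + 1, which add up to the leading factor of the factorial on the right.
binomial-! : ∀ i j → binomial i j * (i ! * j !) ≡ (i + j) !
binomial-! zero    j       = trans (+-identityʳ _) (+-identityʳ _)
binomial-! (suc i) zero    = trans (+-identityʳ _) (trans (*-identityʳ _) (cong _! (sym (+-identityʳ (suc i)))))
binomial-! (suc i) (suc j) = begin
  (binomial i (suc j) + binomial (suc i) j) * (suc i ! * suc j !)
    ≡⟨ solve 6 (λ p q i′ i! j′ j! → (p :+ q) :* ((i′ :* i!) :* (j′ :* j!)) :=
         i′ :* (p :* (i! :* (j′ :* j!))) :+ j′ :* (q :* ((i′ :* i!) :* j!))) refl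
         (binomial i (suc j)) (binomial (suc i) j) (suc i) (i !) (suc j) (j !) ⟩
  suc i * (binomial i (suc j) * (i ! * suc j !)) + suc j * (binomial (suc i) j * (suc i ! * j !))
    ≡⟨ cong₂ (λ u v → suc i * u + suc j * v) (binomial-! i (suc j)) (binomial-! (suc i) j) ⟩
  suc i * (i + suc j) ! + suc j * (suc i + j) !
    ≡⟨ cong (λ n → suc i * (i + suc j) ! + suc j * n !) (sym (+-suc i j)) ⟩
  suc i * (i + suc j) ! + suc j * (i + suc j) !
    ≡⟨ *-distribʳ-+ ((i + suc j) !) (suc i) (suc j) ⟨
  (suc i + suc j) * (i + suc j) ! ∎
  where
  open ≡-Reasoning
  open +-*-Solver

antidiagonal-∑-binomial : ∀ n (c : ℕ → ℕ → ℕ) →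
  antidiagonal-∑ (suc n) (λ i j → binomial i j * c i j) ≡
  antidiagonal-∑ n (λ i j → binomial i j * c (suc i) j) + antidiagonal-∑ n (λ i j → binomial i j * c i (suc j))
antidiagonal-∑-binomial n c = begin
  antidiagonal-∑ (suc n) (λ i j → binomial i j * c i j)
    ≡⟨ antidiagonal-∑-cong (suc n) (λ i j eq → trans (cong (_* c i j) (pascal i j eq)) (*-distribʳ-+ (c i j) (l i j) (r i j))) ⟩
  antidiagonal-∑ (suc n) (λ i j → l i j * c i j + r i j * c i j)
    ≡⟨ antidiagonal-∑-+ (suc n) (λ i j → l i j * c i j) (λ i j → r i j * c i j) ⟩
  antidiagonal-∑ (suc n) (λ i j → l i j * c i j) + antidiagonal-∑ (suc n) (λ i j → r i j * c i j)
    ≡⟨ cong₂ _+_ (antidiagonal-∑-suc n (λ i j → l i j * c i j)) (+-identityʳ _) ⟩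
  antidiagonal-∑ n (λ i j → binomial i j * c (suc i) j) + antidiagonal-∑ n (λ i j → binomial i j * c i (suc j)) ∎
  where
  open ≡-Reasoning
  -- The two summands of Pascal's rule, continued by 0 beyond the border. The only failure would be
  -- at (0 , 0), which the condition `i + j ≡ suc n` excludes.
  l r : ℕ → ℕ → ℕ
  l zero    j = 0
  l (suc i) j = binomial i j
  r i zero    = 0
  r i (suc j) = binomial i j
  pascal : ∀ i j → i + j ≡ suc n → binomial i j ≡ l i j + r i j
  pascal zero    (suc j) _ = refl
  pascal (suc i) zero    _ = trans (sym (binomial-zeroʳ i)) (sym (+-identityʳ _))
  pascal (suc i) (suc j) _ = refl

-- `binomial i j` counts the splits with parts of sizes i and j: the head joins one part or the
-- other, which is Pascal's rule.
∑-splits-length : ∀ (xs : List A) (c : ℕ → ℕ → ℕ) →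
  ∑ (splits xs) (λ (X , Y) → c (length X) (length Y)) ≡
  antidiagonal-∑ (length xs) (λ i j → binomial i j * c i j)
∑-splits-length []       c = refl
∑-splits-length (x ∷ xs) c = begin
  ∑ (splits (x ∷ xs)) (λ (X , Y) → c (length X) (length Y))
    ≡⟨ ∑-splits-∷ x xs _ ⟩
  ∑ (splits xs) (λ (X , Y) → c (suc (length X)) (length Y)) + ∑ (splits xs) (λ (X , Y) → c (length X) (suc (length Y)))
    ≡⟨ cong₂ _+_ (∑-splits-length xs _) (∑-splits-length xs _) ⟩
  antidiagonal-∑ (length xs) (λ i j → binomial i j * c (suc i) j)
    + antidiagonal-∑ (length xs) (λ i j → binomial i j * c i (suc j))
    ≡⟨ antidiagonal-∑-binomial (length xs) c ⟨
  antidiagonal-∑ (suc (length xs)) (λ i j → binomial i j * c i j) ∎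
  where open ≡-Reasoning

∑-splits-swap : ∀ (xs : List A) f → ∑ (splits xs) (f ∘ swap) ≡ ∑ (splits xs) f
∑-splits-swap []       f = refl
∑-splits-swap (x ∷ xs) f = begin
  ∑ (splits (x ∷ xs)) (f ∘ swap)                                             ≡⟨ ∑-splits-∷ x xs (f ∘ swap) ⟩
  ∑ (splits xs) (f ∘ map₂ (x ∷_) ∘ swap) + ∑ (splits xs) (f ∘ map₁ (x ∷_) ∘ swap)
                                                                             ≡⟨ cong₂ _+_ (∑-splits-swap xs _) (∑-splits-swap xs _) ⟩
  ∑ (splits xs) (f ∘ map₂ (x ∷_)) + ∑ (splits xs) (f ∘ map₁ (x ∷_))          ≡⟨ +-comm _ (∑ (splits xs) (f ∘ map₁ (x ∷_))) ⟩
  ∑ (splits xs) (f ∘ map₁ (x ∷_)) + ∑ (splits xs) (f ∘ map₂ (x ∷_))          ≡⟨ ∑-splits-∷ x xs f ⟨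
  ∑ (splits (x ∷ xs)) f                                                      ∎
  where open ≡-Reasoning

-- Counting

s-⊆ : ∀ k π → s k π ⊆ π
s-⊆ k π = ⊆-trans (++⁺ before (takeWhile-⊆ (k ≤?_) _)) (⊆-reflexive split)
  where
  before : reverse (takeWhile (k ≤?_) (reverse (proj₁ (break (k ≟_) π)))) ⊆ proj₁ (break (k ≟_) π)
  before = subst (reverse (takeWhile (k ≤?_) (reverse (proj₁ (break (k ≟_) π)))) ⊆_) (reverse-involutive _)
    (reverse⁺ (takeWhile-⊆ (k ≤?_) (reverse (proj₁ (break (k ≟_) π)))))
  split : uncurry _++_ (break (k ≟_) π) ≡ π
  split = trans (cong (uncurry _++_) (span-defn (¬? ∘ (k ≟_)) π)) (takeWhile++dropWhile (¬? ∘ (k ≟_)) π)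

≺-g⇒≺ : ∀ {σ} k π → σ ≺ g k π → σ ≺ π
≺-g⇒≺ k π = ≺-resp-⊆ (s-⊆ k π) ∘ ≺-resp-iso (iso-sym (iso-rescale (s k π)))

avoids-g : ∀ σ k π → avoids σ (g k π) ≡ avoids σ (s k π)
avoids-g σ k π = sym (avoids-iso σ (iso-rescale (s k π)))

-- `[1⋯ 2 + k ]` unfolds to `1 ∷ 2 ∷ [3⋯2+ k ]`, which isolates the two entries that determine the
-- block of 2.
[3⋯2+_] : ℕ → List ℕ
[3⋯2+ k ] = applyUpTo (3 +_) k

[3⋯2+]-≥3 : ∀ k → All (3 ≤_) [3⋯2+ k ]
[3⋯2+]-≥3 k = All.applyUpTo⁺₂ (3 +_) k (λ i → s≤s (s≤s (s≤s z≤n)))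

increasing-[3⋯2+] : ∀ k → Increasing [3⋯2+ k ]
increasing-[3⋯2+] k = AllPairs.applyUpTo⁺₁ (3 +_) k (λ i<j _ → s≤s (s≤s (s≤s i<j)))

module _ (σ : List ℕ) where

  private
    a : ℕ → ℕ
    a n = ∣Av n ∣ σ

  -- The subtraction of counts holds permutation by permutation. It is written as a sum to keep
  -- truncated subtraction out.
  ∉Av+avoids : ∀ k π → [ ¬? (π ∈Av?[ σ ؛ k ]) ]? + avoids σ π ≡ avoids σ (g k π)
  ∉Av+avoids k π with σ ≺? π | σ ≺? g k π | ≺-g⇒≺ {σ} k π
  ... | yes _  | yes _ | _ = refl
  ... | yes _  | no _  | _ = refl
  ... | no _   | no _  | _ = refl
  ... | no ¬≺π | yes ≺g | ≺g⇒ = ⊥-elim (¬≺π (≺g⇒ ≺g))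

  module _ {k : ℕ} {X Y α β : List ℕ} (X⊆ : X ⊆ [3⋯2+ k ]) (Y⊆ : Y ⊆ [3⋯2+ k ]) where

    avoids-g-left : α ↭ 2 ∷ X → β ↭ Y → avoids σ (g 2 (α ++ 1 ∷ β)) ≡ avoids σ α
    avoids-g-left α↭ β↭ = trans (avoids-g σ 2 (α ++ 1 ∷ β)) (cong (avoids σ)
      (s-left ≤-refl (∈-resp-↭ (↭-sym α↭) (here refl))
        (All-resp-↭ (↭-sym α↭) (≤-refl ∷ All.map <⇒≤ (All-resp-⊆ X⊆ ([3⋯2+]-≥3 k))))))

    avoids-g-right : α ↭ X → β ↭ 2 ∷ Y → avoids σ (g 2 (α ++ 1 ∷ β)) ≡ avoids σ β
    avoids-g-right α↭ β↭ = trans (avoids-g σ 2 (α ++ 1 ∷ β)) (cong (avoids σ)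
      (s-right ≤-refl
        (λ 2∈ → <-irrefl refl (All.lookup (All-resp-⊆ X⊆ ([3⋯2+]-≥3 k)) (∈-resp-↭ α↭ 2∈)))
        (∈-resp-↭ (↭-sym β↭) (here refl))
        (All-resp-↭ (↭-sym β↭) (≤-refl ∷ All.map <⇒≤ (All-resp-⊆ Y⊆ ([3⋯2+]-≥3 k))))))

  private
    ∑-perms-2∷ : ∀ {k X} → X ⊆ [3⋯2+ k ] → ∑ (perms (2 ∷ X)) (avoids σ) ≡ a (suc (length X))
    ∑-perms-2∷ {k} X⊆ = ∑-perms-avoids σ (All-resp-⊆ X⊆ ([3⋯2+]-≥3 k) ∷ AllPairs-resp-⊆ X⊆ (increasing-[3⋯2+] k))

  -- Here i is the number of further entries on the same side of 1 as 2, so the block has i + 1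
  -- entries; the j entries on the other side may stand in any order.
  count-avoids-g : ∀ k → ∑ (perms [1⋯ 2 + k ]) (avoids σ ∘ g 2) ≡
                   2 * antidiagonal-∑ k (λ i j → binomial i j * (j ! * a (suc i)))
  count-avoids-g k = begin
    ∑ (perms (1 ∷ 2 ∷ zs)) f
      ≡⟨ ∑-perms-∷ 1 (2 ∷ zs) f ⟩
    ∑ (perms (2 ∷ zs)) (λ π → ∑ (insertions 1 π) f)
      ≡⟨ ∑-cong (perms (2 ∷ zs)) (λ {π} _ → ∑-map (glue 1) (cuts π) f) ⟩
    ∑ (perms (2 ∷ zs)) (λ π → ∑ (cuts π) (f ∘ glue 1))
      ≡⟨ ∑-perms-cuts (2 ∷ zs) (f ∘ glue 1) ⟩
    ∑ (splits (2 ∷ zs)) (λ (X , Y) → ∑ (perms X) (λ α → ∑ (perms Y) (λ β → f (α ++ 1 ∷ β))))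
      ≡⟨ ∑-splits-∷ 2 zs _ ⟩
    ∑ (splits zs) (λ (X , Y) → ∑ (perms (2 ∷ X)) (λ α → ∑ (perms Y) (λ β → f (α ++ 1 ∷ β))))
      + ∑ (splits zs) (λ (X , Y) → ∑ (perms X) (λ α → ∑ (perms (2 ∷ Y)) (λ β → f (α ++ 1 ∷ β))))
      ≡⟨ cong₂ _+_ (∑-cong (splits zs) (λ { {X , Y} s∈ → left s∈ })) (∑-cong (splits zs) (λ { {X , Y} s∈ → right s∈ })) ⟩
    ∑ (splits zs) c + ∑ (splits zs) (c ∘ swap)
      -- Having 2 to the right of 1 mirrors having it to the left, whence the factor 2.
      ≡⟨ cong (∑ (splits zs) c +_) (trans (∑-splits-swap zs c) (sym (+-identityʳ _))) ⟩
    2 * ∑ (splits zs) c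
      ≡⟨ cong (2 *_) (∑-splits-length zs (λ i j → j ! * a (suc i))) ⟩
    2 * antidiagonal-∑ (length zs) (λ i j → binomial i j * (j ! * a (suc i)))
      ≡⟨ cong (λ n → 2 * antidiagonal-∑ n (λ i j → binomial i j * (j ! * a (suc i)))) (length-applyUpTo (3 +_) k) ⟩
    2 * antidiagonal-∑ k (λ i j → binomial i j * (j ! * a (suc i))) ∎
    where
    open ≡-Reasoning
    zs = [3⋯2+ k ]
    f = avoids σ ∘ g 2
    c : List ℕ × List ℕ → ℕ
    c (X , Y) = length Y ! * a (suc (length X))
    left : ∀ {X Y} → (X , Y) ∈ splits zs →
           ∑ (perms (2 ∷ X)) (λ α → ∑ (perms Y) (λ β → f (α ++ 1 ∷ β))) ≡ length Y ! * a (suc (length X))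
    left {X} {Y} s∈ = let X⊆ , Y⊆ = ∈-splits⁻ zs s∈ in begin
      ∑ (perms (2 ∷ X)) (λ α → ∑ (perms Y) (λ β → f (α ++ 1 ∷ β)))
        ≡⟨ ∑-cong (perms (2 ∷ X)) (λ α∈ → ∑-cong (perms Y) (λ β∈ →
             avoids-g-left X⊆ Y⊆ (∈-perms⁻ (2 ∷ X) α∈) (∈-perms⁻ Y β∈))) ⟩
      ∑ (perms (2 ∷ X)) (λ α → ∑ (perms Y) (λ _ → avoids σ α))
        ≡⟨ ∑-cong (perms (2 ∷ X)) (λ _ → ∑-const (perms Y) _) ⟩
      ∑ (perms (2 ∷ X)) (λ α → length (perms Y) * avoids σ α)
        ≡⟨ ∑-*ˡ (length (perms Y)) (perms (2 ∷ X)) (avoids σ) ⟩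
      length (perms Y) * ∑ (perms (2 ∷ X)) (avoids σ)
        ≡⟨ cong₂ _*_ (length-perms Y) (∑-perms-2∷ X⊆) ⟩
      length Y ! * a (suc (length X)) ∎
    right : ∀ {X Y} → (X , Y) ∈ splits zs →
           ∑ (perms X) (λ α → ∑ (perms (2 ∷ Y)) (λ β → f (α ++ 1 ∷ β))) ≡ length X ! * a (suc (length Y))
    right {X} {Y} s∈ = let X⊆ , Y⊆ = ∈-splits⁻ zs s∈ in begin
      ∑ (perms X) (λ α → ∑ (perms (2 ∷ Y)) (λ β → f (α ++ 1 ∷ β)))
        ≡⟨ ∑-cong (perms X) (λ α∈ → ∑-cong (perms (2 ∷ Y)) (λ β∈ →
             avoids-g-right X⊆ Y⊆ (∈-perms⁻ X α∈) (∈-perms⁻ (2 ∷ Y) β∈))) ⟩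
      ∑ (perms X) (λ _ → ∑ (perms (2 ∷ Y)) (avoids σ))
        ≡⟨ ∑-const (perms X) _ ⟩
      length (perms X) * ∑ (perms (2 ∷ Y)) (avoids σ)
        ≡⟨ cong₂ _*_ (length-perms X) (∑-perms-2∷ Y⊆) ⟩
      length X ! * a (suc (length Y)) ∎

  ∣∉Av∣ : ℕ → ℕ
  ∣∉Av∣ n = length (filter (λ π → ¬? (π ∈Av?[ σ ؛ 2 ])) (𝒮 n))

  ∣∉Av∣+∣Av∣ : ∀ k → ∣∉Av∣ (2 + k) + a (2 + k) ≡
             2 * antidiagonal-∑ k (λ i j → binomial i j * (j ! * a (suc i)))
  ∣∉Av∣+∣Av∣ k = begin
    ∣∉Av∣ (2 + k) + a (2 + k)
      ≡⟨ cong₂ _+_ (count-𝒮 (λ π → ¬? (π ∈Av?[ σ ؛ 2 ])) (2 + k)) (∣Av∣≡∑ σ (2 + k)) ⟩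
    ∑ (perms [1⋯ 2 + k ]) (λ π → [ ¬? (π ∈Av?[ σ ؛ 2 ]) ]?) + ∑ (perms [1⋯ 2 + k ]) (avoids σ)
      ≡⟨ ∑-+ (perms [1⋯ 2 + k ]) _ _ ⟨
    ∑ (perms [1⋯ 2 + k ]) (λ π → [ ¬? (π ∈Av?[ σ ؛ 2 ]) ]? + avoids σ π)
      ≡⟨ ∑-cong (perms [1⋯ 2 + k ]) (λ {π} _ → ∉Av+avoids 2 π) ⟩
    ∑ (perms [1⋯ 2 + k ]) (avoids σ ∘ g 2)
      ≡⟨ count-avoids-g k ⟩
    2 * antidiagonal-∑ k (λ i j → binomial i j * (j ! * a (suc i))) ∎
    where open ≡-Reasoning

  -- The first m and the last n entries of a permutation avoiding σ avoid σ.
  ∣Av∣-submultiplicative : ∀ m n → a (m + n) ≤ binomial m n * (a m * a n)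
  ∣Av∣-submultiplicative m n = begin
    a (m + n)
      ≡⟨ ∣Av∣≡∑ σ (m + n) ⟩
    ∑ (perms zs) (avoids σ)
      ≤⟨ ∑-mono (perms zs) (λ π∈ → cut-at-m _ (trans (length-perms-∈ zs π∈) length-zs)) ⟩
    ∑ (perms zs) (λ π → ∑ (cuts π) h)
      ≡⟨ ∑-perms-cuts zs h ⟩
    ∑ (splits zs) (λ (X , Y) → ∑ (perms X) (λ α → ∑ (perms Y) (λ β → h (α , β))))
      ≡⟨ ∑-cong (splits zs) (λ { {X , Y} s∈ → let X⊆ , Y⊆ = ∈-splits⁻ zs s∈ in factor
           (AllPairs-resp-⊆ X⊆ increasing-[1⋯ m + n ]) (AllPairs-resp-⊆ Y⊆ increasing-[1⋯ m + n ]) }) ⟩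
    ∑ (splits zs) (λ (X , Y) → δ (length X) m * (a (length X) * a (length Y)))
      ≡⟨ ∑-splits-length zs (λ i j → δ i m * (a i * a j)) ⟩
    antidiagonal-∑ (length zs) (λ i j → binomial i j * (δ i m * (a i * a j)))
      ≡⟨ cong (λ l → antidiagonal-∑ l (λ i j → binomial i j * (δ i m * (a i * a j)))) length-zs ⟩
    antidiagonal-∑ (m + n) (λ i j → binomial i j * (δ i m * (a i * a j)))
      ≡⟨ antidiagonal-∑-cong (m + n) (λ i j _ →
           solve 3 (λ x y z → x :* (y :* z) := y :* (x :* z)) refl (binomial i j) (δ i m) (a i * a j)) ⟩
    antidiagonal-∑ (m + n) (λ i j → δ i m * (binomial i j * (a i * a j)))
      ≡⟨ antidiagonal-∑-δ m n (λ i j → binomial i j * (a i * a j)) ⟩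
    binomial m n * (a m * a n) ∎
    where
    open ≤-Reasoning
    open +-*-Solver
    zs = [1⋯ m + n ]
    length-zs : length zs ≡ m + n
    length-zs = length-applyUpTo suc (m + n)
    -- The delta retains only the cut after m entries, so that a sum over all cuts, to which
    -- `∑-perms-cuts` applies, can stand for this one cut.
    h : List ℕ × List ℕ → ℕ
    h (α , β) = δ (length α) m * (avoids σ α * avoids σ β)
    avoids-⊆ : ∀ π α β → α ⊆ π → β ⊆ π → avoids σ π ≤ avoids σ α * avoids σ β
    avoids-⊆ π α β α⊆ β⊆ with σ ≺? π | σ ≺? α | σ ≺? β
    ... | yes _ | _      | _      = z≤n
    ... | no ⊀π | yes ≺α | _      = ⊥-elim (⊀π (≺-resp-⊆ α⊆ ≺α))
    ... | no ⊀π | no _   | yes ≺β = ⊥-elim (⊀π (≺-resp-⊆ β⊆ ≺β))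
    ... | no _  | no _   | no _   = ≤-refl
    cut-at-m : ∀ π → length π ≡ m + n → avoids σ π ≤ ∑ (cuts π) h
    cut-at-m π len = begin
      avoids σ π                              ≤⟨ avoids-⊆ π (take m π) (drop m π) (take-⊆ m π) (drop-⊆ m π) ⟩
      avoids σ (take m π) * avoids σ (drop m π)
                                              ≡⟨ +-identityʳ _ ⟨
      1 * (avoids σ (take m π) * avoids σ (drop m π))
                                              ≡⟨ cong (_* (avoids σ (take m π) * avoids σ (drop m π)))
                                                   (trans (cong (λ l → δ l m) length-take-m) (δ-refl m)) ⟨
      h (take m π , drop m π)                 ≤⟨ ∈⇒≤∑ h (subst (λ l → (take m π , drop m π) ∈ cuts l)
                                                   (take++drop≡id m π) (∈-cuts⁺ (take m π) (drop m π))) ⟩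
      ∑ (cuts π) h                            ∎
      where
      length-take-m : length (take m π) ≡ m
      length-take-m = trans (length-take m π) (m≤n⇒m⊓n≡m (subst (m ≤_) (sym len) (m≤m+n m n)))
    factor : ∀ {X Y} → Increasing X → Increasing Y →
      ∑ (perms X) (λ α → ∑ (perms Y) (λ β → h (α , β))) ≡ δ (length X) m * (a (length X) * a (length Y))
    factor {X} {Y} X↑ Y↑ = begin-equality
      ∑ (perms X) (λ α → ∑ (perms Y) (λ β → h (α , β)))
        ≡⟨ ∑-cong (perms X) (λ {α} α∈ → trans (∑-*ˡ (δ (length α) m) (perms Y) _)
             (cong₂ _*_ (cong (λ l → δ l m) (length-perms-∈ X α∈)) (trans (∑-*ˡ (avoids σ α) (perms Y) (avoids σ))
               (cong (avoids σ α *_) (∑-perms-avoids σ Y↑))))) ⟩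
      ∑ (perms X) (λ α → δ (length X) m * (avoids σ α * a (length Y)))
        ≡⟨ ∑-*ˡ (δ (length X) m) (perms X) _ ⟩
      δ (length X) m * ∑ (perms X) (λ α → avoids σ α * a (length Y))
        ≡⟨ cong (δ (length X) m *_) (trans (∑-*ʳ (a (length Y)) (perms X) (avoids σ))
             (cong (_* a (length Y)) (∑-perms-avoids σ X↑))) ⟩
      δ (length X) m * (a (length X) * a (length Y)) ∎

  ∣Av∣≤! : ∀ n → a n ≤ n !
  ∣Av∣≤! n = begin
    a n              ≤⟨ length-filter (λ π → ¬? (σ ≺? π)) (𝒮 n) ⟩
    length (𝒮 n)     ≡⟨ length-𝒮 n ⟩
    n !              ∎
    where
    open ≤-Reasoning

≺-refl : ∀ σ → σ ≺ σ
≺-refl σ = σ , ⊆-refl , subst₂ OrderIsomorphic (map-id σ) (map-id σ)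
  (map-iso id id (AllPairs-tabulate σ (λ _ _ → mk⇔ id id , mk⇔ id id)))

-- σ is itself a permutation of size m and contains σ. This strictness is the source of the decay.
∣Av∣<! : ∀ m {σ} → σ ∈ 𝒮 m → ∣Av m ∣ σ < m !
∣Av∣<! m {σ} σ∈ = begin-strict
  ∣Av m ∣ σ       <⟨ filter-notAll (λ π → ¬? (σ ≺? π)) (𝒮 m) (lose σ∈ (λ ⊀σ → ⊀σ (≺-refl σ))) ⟩
  length (𝒮 m)    ≡⟨ length-𝒮 m ⟩
  m !             ∎
  where
  open ≤-Reasoning

-- Polynomial bounds from submultiplicativity

module _ {a : ℕ → ℕ} {m M : ℕ} (m>0 : 0 < m) (m!≡1+M : m ! ≡ suc M) (a≤! : ∀ n → a n ≤ n !)
         (a-step : ∀ n → a (m + n) * (m ! * n !) ≤ (m + n) ! * (M * a n)) where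
  open +-*-Solver

  private
    n₀ : ℕ
    n₀ = 7 * m * M + m

    -- The cube of m + n₀: together with `a≤!` it settles every n below m + n₀, where the induction
    -- cannot yet step back by m.
    C : ℕ
    C = (m + n₀) * ((m + n₀) * (m + n₀))

    cube : ℕ → ℕ
    cube n = n * (n * n)

    cube-mono : ∀ {i j} → i ≤ j → cube i ≤ cube j
    cube-mono i≤j = *-mono-≤ i≤j (*-mono-≤ i≤j i≤j)

    -- (1 + m/n)³ ≤ 1 + 7m/n ≤ 1 + 1/M for m ≤ n and 7mM ≤ n.
    cube-step : ∀ n → n₀ ≤ n → cube (m + n) * M ≤ suc M * cube n
    cube-step n n₀≤n = begin
      cube (m + n) * M
        ≡⟨ solve 3 (λ m n M → (m :+ n) :* ((m :+ n) :* (m :+ n)) :* M :=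
             (n :* (n :* n) :+ con 3 :* (n :* n) :* m :+ con 3 :* n :* m :* m :+ m :* m :* m) :* M) refl m n M ⟩
      (cube n + 3 * (n * n) * m + 3 * n * m * m + m * m * m) * M
        ≤⟨ *-monoˡ-≤ M (+-mono-≤
             (+-monoʳ-≤ (cube n + 3 * (n * n) * m) (*-monoˡ-≤ m (*-monoʳ-≤ (3 * n) m≤n)))
             (*-monoˡ-≤ m (*-mono-≤ m≤n m≤n))) ⟩
      (cube n + 3 * (n * n) * m + 3 * n * n * m + n * n * m) * M
        ≡⟨ solve 3 (λ m n M →
             (n :* (n :* n) :+ con 3 :* (n :* n) :* m :+ con 3 :* n :* n :* m :+ n :* n :* m) :* M :=
             n :* n :* (con 7 :* m :* M) :+ M :* (n :* (n :* n))) refl m n M ⟩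
      n * n * (7 * m * M) + M * cube n
        ≤⟨ +-monoˡ-≤ (M * cube n) (*-monoʳ-≤ (n * n) (m+n≤o⇒m≤o (7 * m * M) n₀≤n)) ⟩
      n * n * n + M * cube n
        ≡⟨ cong (_+ M * cube n) (*-assoc n n n) ⟩
      suc M * cube n ∎
      where
      open ≤-Reasoning
      m≤n : m ≤ n
      m≤n = m+n≤o⇒n≤o (7 * m * M) n₀≤n

    bound-step : ∀ n → n₀ ≤ n → cube n * a n ≤ C * n ! → cube (m + n) * a (m + n) ≤ C * (m + n) !
    bound-step n n₀≤n ih = *-cancelʳ-≤ _ _ (m ! * n !) {{m*n≢0 (m !) (n !) {{m !≢0}} {{n !≢0}}}} (begin
      cube (m + n) * a (m + n) * (m ! * n !)            ≡⟨ *-assoc (cube (m + n)) _ _ ⟩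
      cube (m + n) * (a (m + n) * (m ! * n !))          ≤⟨ *-monoʳ-≤ (cube (m + n)) (a-step n) ⟩
      cube (m + n) * ((m + n) ! * (M * a n))            ≡⟨ solve 4 (λ x y M a → x :* (y :* (M :* a)) := (x :* M) :* (y :* a)) refl
                                                             (cube (m + n)) ((m + n) !) M (a n) ⟩
      cube (m + n) * M * ((m + n) ! * a n)              ≤⟨ *-monoˡ-≤ ((m + n) ! * a n) (cube-step n n₀≤n) ⟩
      suc M * cube n * ((m + n) ! * a n)                ≡⟨ solve 4 (λ M x y a → M :* x :* (y :* a) := (x :* a) :* (M :* y)) refl
                                                             (suc M) (cube n) ((m + n) !) (a n) ⟩
      cube n * a n * (suc M * (m + n) !)                ≤⟨ *-monoˡ-≤ (suc M * (m + n) !) ih ⟩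
      C * n ! * (suc M * (m + n) !)                     ≡⟨ cong (λ q → C * n ! * (q * (m + n) !)) m!≡1+M ⟨
      C * n ! * (m ! * (m + n) !)                       ≡⟨ solve 4 (λ C n! m! y → C :* n! :* (m! :* y) := C :* y :* (m! :* n!)) refl
                                                             C (n !) (m !) ((m + n) !) ⟩
      C * (m + n) ! * (m ! * n !)                       ∎)
      where open ≤-Reasoning

  -- With p_n = a n / n!, `a-step` reads p_{m+n} ≤ M/(M+1) p_n. By `cube-step`, from n₀ on the
  -- growth of the cube between n and m + n is at most the inverse factor, so a bound on n³ p_n
  -- propagates in steps of m.
  cubic-bound : ∃[ C ] (∀ n → n * (n * n) * a n ≤ C * n !)
  cubic-bound = C , <-rec (λ n → cube n * a n ≤ C * n !) bound
    where
    bound : ∀ n → (∀ {i} → i < n → cube i * a i ≤ C * i !) → cube n * a n ≤ C * n !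
    bound n ih with m + n₀ ≤? n
    ... | no n≱ = *-mono-≤ (cube-mono (<⇒≤ (≰⇒> n≱))) (a≤! n)
    ... | yes m+n₀≤n with i , refl ← m≤n⇒∃[o]m+o≡n (m+n≤o⇒m≤o m m+n₀≤n) =
      bound-step i (+-cancelˡ-≤ m n₀ i m+n₀≤n) (ih (m<n+m i m>0))

-- Fractions

infixl 7 _÷_

_÷_ : ∀ a b .{{_ : NonZero b}} → ℚ
a ÷ b = ℤ.+ a / b

÷-toℚᵘ : ∀ a b .{{_ : NonZero b}} → toℚᵘ (a ÷ b) ℚᵘ.≃ ((ℤ.+ a) ℚᵘ./ b)
÷-toℚᵘ a (suc b) = ℚ.toℚᵘ-fromℚᵘ (ℚᵘ.mkℚᵘ (ℤ.+ a) b)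

÷-mono-≤ : ∀ a b c d .{{_ : NonZero b}} .{{_ : NonZero d}} → a * d ≤ c * b → a ÷ b ℚ.≤ c ÷ d
÷-mono-≤ a b@(suc _) c d@(suc _) ad≤cb = ℚ.toℚᵘ-cancel-≤ (begin
  toℚᵘ (a ÷ b)   ≃⟨ ÷-toℚᵘ a b ⟩
  (ℤ.+ a) ℚᵘ./ b     ≤⟨ ℚᵘ.*≤* (subst₂ ℤ._≤_ (ℤ.pos-* a d) (ℤ.pos-* c b) (ℤ.+≤+ ad≤cb)) ⟩
  (ℤ.+ c) ℚᵘ./ d     ≃⟨ ÷-toℚᵘ c d ⟨
  toℚᵘ (c ÷ d)   ∎)
  where open ℚᵘ.≤-Reasoning

÷-≡ : ∀ a b c d .{{_ : NonZero b}} .{{_ : NonZero d}} → a * d ≡ c * b → a ÷ b ≡ c ÷ d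
÷-≡ a b c d ad≡cb = ℚ.≤-antisym (÷-mono-≤ a b c d (≤-reflexive ad≡cb)) (÷-mono-≤ c d a b (≤-reflexive (sym ad≡cb)))

÷-* : ∀ a b c d .{{_ : NonZero b}} .{{_ : NonZero d}} →
      (a ÷ b) ℚ.* (c ÷ d) ≡ ((a * c) ÷ (b * d)) {{m*n≢0 b d}}
÷-* a b@(suc _) c d@(suc _) = ℚ.toℚᵘ-injective (begin
  toℚᵘ ((a ÷ b) ℚ.* (c ÷ d))             ≈⟨ ℚ.toℚᵘ-homo-* (a ÷ b) (c ÷ d) ⟩
  toℚᵘ (a ÷ b) ℚᵘ.* toℚᵘ (c ÷ d)       ≈⟨ ℚᵘ.*-cong (÷-toℚᵘ a b) (÷-toℚᵘ c d) ⟩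
  ((ℤ.+ a) ℚᵘ./ b) ℚᵘ.* ((ℤ.+ c) ℚᵘ./ d)       ≈⟨ ℚᵘ.*≡* (cong (ℤ._* ℤ.+ (b * d)) (sym (ℤ.pos-* a c))) ⟩
  (ℤ.+ (a * c)) ℚᵘ./ (b * d)             ≈⟨ ÷-toℚᵘ (a * c) (b * d) ⟨
  toℚᵘ ((a * c) ÷ (b * d))           ∎)
  where open import Relation.Binary.Reasoning.Setoid ℚᵘ.≃-setoid

÷-+ : ∀ a b c d .{{_ : NonZero b}} .{{_ : NonZero d}} →
      (a ÷ b) ℚ.+ (c ÷ d) ≡ ((a * d + c * b) ÷ (b * d)) {{m*n≢0 b d}}
÷-+ a b@(suc _) c d@(suc _) = ℚ.toℚᵘ-injective (begin
  toℚᵘ ((a ÷ b) ℚ.+ (c ÷ d))             ≈⟨ ℚ.toℚᵘ-homo-+ (a ÷ b) (c ÷ d) ⟩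
  toℚᵘ (a ÷ b) ℚᵘ.+ toℚᵘ (c ÷ d)       ≈⟨ ℚᵘ.+-cong (÷-toℚᵘ a b) (÷-toℚᵘ c d) ⟩
  ((ℤ.+ a) ℚᵘ./ b) ℚᵘ.+ ((ℤ.+ c) ℚᵘ./ d)       ≈⟨ ℚᵘ.*≡* (cong (ℤ._* ℤ.+ (b * d)) (sym num)) ⟩
  (ℤ.+ (a * d + c * b)) ℚᵘ./ (b * d) ≈⟨ ÷-toℚᵘ (a * d + c * b) (b * d) ⟨
  toℚᵘ ((a * d + c * b) ÷ (b * d)) ∎)
  where
  open import Relation.Binary.Reasoning.Setoid ℚᵘ.≃-setoid
  num : ℤ.+ (a * d + c * b) ≡ (ℤ.+ a) ℤ.* (ℤ.+ d) ℤ.+ (ℤ.+ c) ℤ.* (ℤ.+ b)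
  num = trans (ℤ.pos-+ (a * d) (c * b)) (cong₂ ℤ._+_ (ℤ.pos-* a d) (ℤ.pos-* c b))

abstract
  -- The embedding of ℕ in ℚ. It is abstract so that `ι n` remains an atom, handled only through the
  -- laws of this block.
  ι : ℕ → ℚ
  ι n = n ÷ 1

  ι-+ : ∀ a b → ι (a + b) ≡ ι a ℚ.+ ι b
  ι-+ a b = sym (trans (÷-+ a 1 b 1) (÷-≡ (a * 1 + b * 1) 1 (a + b) 1
    (cong (_* 1) (cong₂ _+_ (*-identityʳ a) (*-identityʳ b)))))

  ι-* : ∀ a b → ι (a * b) ≡ ι a ℚ.* ι b
  ι-* a b = sym (÷-* a 1 b 1)

  ι-mono-≤ : ∀ {a b} → a ≤ b → ι a ℚ.≤ ι b
  ι-mono-≤ {a} {b} a≤b = ÷-mono-≤ a 1 b 1 (*-monoˡ-≤ 1 a≤b)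

  ÷-*-ι : ∀ a b .{{_ : NonZero b}} → (a ÷ b) ℚ.* ι b ≡ ι a
  ÷-*-ι a b = trans (÷-* a b b 1)
    (÷-≡ (a * b) (b * 1) a 1 {{m*n≢0 b 1}} (trans (*-identityʳ _) (cong (a *_) (sym (*-identityʳ b)))))

  ι-one : ι 1 ≡ 1ℚ
  ι-one = refl

  instance
    ι-pos : ∀ {n} .{{_ : NonZero n}} → ℚ.Positive (ι n)
    ι-pos {n} = ℚ.normalize-pos n 1

    ι-nonNeg : ∀ {n} → ℚ.NonNegative (ι n)
    ι-nonNeg {n} = ℚ.normalize-nonNeg n 1

÷-nonNeg : ∀ a b .{{_ : NonZero b}} → 0ℚ ℚ.≤ a ÷ b
÷-nonNeg a b = ℚ.nonNegative⁻¹ (a ÷ b) {{ℚ.normalize-nonNeg a b}}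

-- A positive rational times its denominator is its numerator, which is at least 1; D times the
-- denominator is therefore a sufficient threshold.
archimedean : ∀ ε → 0ℚ ℚ.< ε → ∀ D → ∃[ N ] (∀ n → N ≤ n → ι D ℚ.≤ ε ℚ.* ι n)
archimedean ε 0<ε D = D * ↧ₙ ε , λ n N≤n → begin
  ι D                             ≡⟨ ℚ.*-identityˡ (ι D) ⟨
  1ℚ ℚ.* ι D                       ≤⟨ ℚ.*-monoʳ-≤-nonNeg (ι D) (ι≤↥ ε 0<ε) ⟩
  ε ℚ.* ι (↧ₙ ε) ℚ.* ι D              ≡⟨ ℚ.*-assoc ε _ _ ⟩
  ε ℚ.* (ι (↧ₙ ε) ℚ.* ι D)            ≡⟨ cong (ε ℚ.*_) (trans (ℚ.*-comm _ (ι D)) (sym (ι-* D (↧ₙ ε)))) ⟩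
  ε ℚ.* ι (D * ↧ₙ ε)              ≤⟨ ℚ.*-monoˡ-≤-nonNeg ε {{ℚ.pos⇒nonNeg ε {{ℚ.positive 0<ε}}}} (ι-mono-≤ N≤n) ⟩
  ε ℚ.* ι n                         ∎
  where
  open ℚ.≤-Reasoning
  ι≤↥ : ∀ ε → 0ℚ ℚ.< ε → 1ℚ ℚ.≤ ε ℚ.* ι (↧ₙ ε)
  ι≤↥ ε 0<ε with ε | ℚ.positive 0<ε | ℚ.↥p/↧p≡p ε
  ... | mkℚ ℤ.+[1+ p ] d _ | _ | eq = subst (λ q → 1ℚ ℚ.≤ q ℚ.* ι (suc d)) eq
    (subst₂ ℚ._≤_ ι-one (sym (÷-*-ι (suc p) (suc d))) (ι-mono-≤ (s≤s z≤n)))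

-- Partial sums and the limit

∣p∣≤ : ∀ {p q} → p ℚ.≤ q → ℚ.- p ℚ.≤ q → ℚ.∣ p ∣ ℚ.≤ q
∣p∣≤ {p} p≤q -p≤q with ℚ.∣p∣≡p∨∣p∣≡-p p
... | inj₁ eq = subst (ℚ._≤ _) (sym eq) p≤q
... | inj₂ eq = subst (ℚ._≤ _) (sym eq) -p≤q

*-monoʳ-≤-0≤ : ∀ {p q r} → 0ℚ ℚ.≤ r → p ℚ.≤ q → r ℚ.* p ℚ.≤ r ℚ.* q
*-monoʳ-≤-0≤ {r = r} 0≤r = ℚ.*-monoˡ-≤-nonNeg r {{ℚ.nonNegative 0≤r}}

0≤* : ∀ {p q} → 0ℚ ℚ.≤ p → 0ℚ ℚ.≤ q → 0ℚ ℚ.≤ p ℚ.* q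
0≤* {p} {q} 0≤p 0≤q = subst (ℚ._≤ p ℚ.* q) (ℚ.*-zeroʳ p) (*-monoʳ-≤-0≤ 0≤p 0≤q)

0≤ι : ∀ n → 0ℚ ℚ.≤ ι n
0≤ι n = ℚ.nonNegative⁻¹ (ι n)

p≤p+q : ∀ {p q} → 0ℚ ℚ.≤ q → p ℚ.≤ p ℚ.+ q
p≤p+q {p} {q} 0≤q = subst (ℚ._≤ p ℚ.+ q) (ℚ.+-identityʳ p) (ℚ.+-monoʳ-≤ p 0≤q)

p-q≤p : ∀ {p q} → 0ℚ ℚ.≤ q → p ℚ.- q ℚ.≤ p
p-q≤p {p} {q} 0≤q = subst (p ℚ.- q ℚ.≤_) (ℚ.+-identityʳ p) (ℚ.+-monoʳ-≤ p (ℚ.neg-antimono-≤ 0≤q))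

-- With n = κ + 1, x is the probability, y = 2/n² and h, h′ are the partial sums of index κ and l ≥ κ.
module _ {x y ε h h′ f κ c A N : ℚ}
  (0<κ : 0ℚ ℚ.< κ) (0<f : 0ℚ ℚ.< f) (0≤y : 0ℚ ℚ.≤ y) (0≤h : 0ℚ ℚ.≤ h) (0≤c : 0ℚ ℚ.≤ c) (0≤A : 0ℚ ℚ.≤ A)
  (x≡ : x ℚ.* ((1ℚ ℚ.+ κ) ℚ.* (κ ℚ.* f)) ≡ N) (N+A≡ : N ℚ.+ A ≡ (1ℚ ℚ.+ 1ℚ) ℚ.* (f ℚ.* h))
  (y≡ : y ℚ.* ((1ℚ ℚ.+ κ) ℚ.* (1ℚ ℚ.+ κ)) ≡ 1ℚ ℚ.+ 1ℚ) (h≤h′ : h ℚ.≤ h′)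
  (tail : κ ℚ.* (h′ ℚ.- h) ℚ.≤ c) (A≤ : (1ℚ ℚ.+ κ) ℚ.* A ℚ.≤ c ℚ.* f)
  (c≤ch′ : c ℚ.≤ c ℚ.* h′) (ε≥ : 1ℚ ℚ.+ (c ℚ.+ c) ℚ.≤ ε ℚ.* κ)
  where
  open ℚSolver.+-*-Solver
  open ℚ.≤-Reasoning

  private
    T = 1ℚ ℚ.+ 1ℚ
    ν = 1ℚ ℚ.+ κ
    -- With ν = n and f = (n-2)!, this is n · n!. Multiplying by it clears the denominator n! of x
    -- and the denominator n² of y at once.
    W = (ν ℚ.* ν) ℚ.* (κ ℚ.* f)

    0≤κ = ℚ.<⇒≤ 0<κ
    0≤f = ℚ.<⇒≤ 0<f
    0≤h′ = ℚ.≤-trans 0≤h h≤h′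

    0≤T : 0ℚ ℚ.≤ T
    0≤T = ℚ.nonNegative⁻¹ T

    instance
      W-pos : ℚ.Positive W
      W-pos = ℚ.pos*pos⇒pos (ν ℚ.* ν) {{ℚ.pos*pos⇒pos ν {{ν-pos}} ν {{ν-pos}}}}
                            (κ ℚ.* f) {{ℚ.pos*pos⇒pos κ {{ℚ.positive 0<κ}} f {{ℚ.positive 0<f}}}}
        where
        ν-pos : ℚ.Positive ν
        ν-pos = ℚ.pos+pos⇒pos 1ℚ κ {{ℚ.positive 0<κ}}

    N≡ : N ≡ T ℚ.* (f ℚ.* h) ℚ.- A
    N≡ = trans (solve 2 (λ N A → N := (N :+ A) :- A) refl N A) (cong (ℚ._- A) N+A≡)

    scaled : (x ℚ.- y ℚ.* h′) ℚ.* W ≡ ν ℚ.* N ℚ.- T ℚ.* (h′ ℚ.* (κ ℚ.* f))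
    scaled = begin-equality
      (x ℚ.- y ℚ.* h′) ℚ.* W
        ≡⟨ solve 6 (λ x y h′ ν κ f → (x :- y :* h′) :* ((ν :* ν) :* (κ :* f)) :=
             ν :* (x :* (ν :* (κ :* f))) :- (y :* (ν :* ν)) :* (h′ :* (κ :* f))) refl x y h′ ν κ f ⟩
      ν ℚ.* (x ℚ.* (ν ℚ.* (κ ℚ.* f))) ℚ.- (y ℚ.* (ν ℚ.* ν)) ℚ.* (h′ ℚ.* (κ ℚ.* f))
        ≡⟨ cong₂ (λ p q → ν ℚ.* p ℚ.- q ℚ.* (h′ ℚ.* (κ ℚ.* f))) x≡ y≡ ⟩
      ν ℚ.* N ℚ.- T ℚ.* (h′ ℚ.* (κ ℚ.* f)) ∎

    target : T ℚ.* f ℚ.* (h′ ℚ.* (ε ℚ.* κ)) ≡ ε ℚ.* (y ℚ.* h′) ℚ.* W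
    target = begin-equality
      T ℚ.* f ℚ.* (h′ ℚ.* (ε ℚ.* κ))
        ≡⟨ cong (λ T → T ℚ.* f ℚ.* (h′ ℚ.* (ε ℚ.* κ))) y≡ ⟨
      y ℚ.* (ν ℚ.* ν) ℚ.* f ℚ.* (h′ ℚ.* (ε ℚ.* κ))
        ≡⟨ solve 6 (λ y ν f h′ ε κ → y :* (ν :* ν) :* f :* (h′ :* (ε :* κ)) :=
             ε :* (y :* h′) :* ((ν :* ν) :* (κ :* f))) refl y ν f h′ ε κ ⟩
      ε ℚ.* (y ℚ.* h′) ℚ.* W ∎

    -- Dropping A and enlarging h to h′ only increases x. What remains is the excess of n² over
    -- n(n-1), that is ν - κ = 1, and the summand 1 in `ε≥` absorbs it.
    upper : x ℚ.- y ℚ.* h′ ℚ.≤ ε ℚ.* (y ℚ.* h′)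
    upper = ℚ.*-cancelʳ-≤-pos W (begin
      (x ℚ.- y ℚ.* h′) ℚ.* W
        ≡⟨ scaled ⟩
      ν ℚ.* N ℚ.- T ℚ.* (h′ ℚ.* (κ ℚ.* f))
        ≤⟨ ℚ.+-monoˡ-≤ _ (*-monoʳ-≤-0≤ 0≤ν N≤) ⟩
      ν ℚ.* (T ℚ.* (f ℚ.* h′)) ℚ.- T ℚ.* (h′ ℚ.* (κ ℚ.* f))
        ≡⟨ solve 4 (λ T κ f h′ → (con 1ℚ :+ κ) :* (T :* (f :* h′)) :- T :* (h′ :* (κ :* f)) := T :* f :* (h′ :* con 1ℚ))
             refl T κ f h′ ⟩
      T ℚ.* f ℚ.* (h′ ℚ.* 1ℚ)
        ≤⟨ *-monoʳ-≤-0≤ (0≤* 0≤T 0≤f) (*-monoʳ-≤-0≤ 0≤h′ (ℚ.≤-trans (p≤p+q (ℚ.+-mono-≤ 0≤c 0≤c)) ε≥)) ⟩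
      T ℚ.* f ℚ.* (h′ ℚ.* (ε ℚ.* κ))
        ≡⟨ target ⟩
      ε ℚ.* (y ℚ.* h′) ℚ.* W ∎)
      where
      0≤ν : 0ℚ ℚ.≤ ν
      0≤ν = ℚ.+-mono-≤ {0ℚ} {1ℚ} (ℚ.nonNegative⁻¹ 1ℚ) 0≤κ
      N≤ : N ℚ.≤ T ℚ.* (f ℚ.* h′)
      N≤ = begin
        N                           ≡⟨ N≡ ⟩
        T ℚ.* (f ℚ.* h) ℚ.- A       ≤⟨ p-q≤p 0≤A ⟩
        T ℚ.* (f ℚ.* h)             ≤⟨ *-monoʳ-≤-0≤ 0≤T (*-monoʳ-≤-0≤ 0≤f h≤h′) ⟩
        T ℚ.* (f ℚ.* h′)            ∎

    -- The losses are the tail h′ - h and the count A, both bounded by means of c, while the excess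
    -- of n² over n(n-1) now helps and is dropped. `c≤ch′` makes these absolute bounds relative to
    -- h′.
    lower : ℚ.- (x ℚ.- y ℚ.* h′) ℚ.≤ ε ℚ.* (y ℚ.* h′)
    lower = ℚ.*-cancelʳ-≤-pos W (begin
      ℚ.- (x ℚ.- y ℚ.* h′) ℚ.* W
        ≡⟨ ℚ.neg-distribˡ-* (x ℚ.- y ℚ.* h′) W ⟨
      ℚ.- ((x ℚ.- y ℚ.* h′) ℚ.* W)
        ≡⟨ cong ℚ.-_ (trans scaled (cong (λ N → ν ℚ.* N ℚ.- T ℚ.* (h′ ℚ.* (κ ℚ.* f))) N≡)) ⟩
      ℚ.- (ν ℚ.* (T ℚ.* (f ℚ.* h) ℚ.- A) ℚ.- T ℚ.* (h′ ℚ.* (κ ℚ.* f)))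
        ≡⟨ solve 6 (λ T κ f h h′ A → :- ((con 1ℚ :+ κ) :* (T :* (f :* h) :- A) :- T :* (h′ :* (κ :* f))) :=
             (T :* f :* (κ :* (h′ :- h)) :+ (con 1ℚ :+ κ) :* A) :- T :* (f :* h)) refl T κ f h h′ A ⟩
      (T ℚ.* f ℚ.* (κ ℚ.* (h′ ℚ.- h)) ℚ.+ ν ℚ.* A) ℚ.- T ℚ.* (f ℚ.* h)
        ≤⟨ p-q≤p (0≤* 0≤T (0≤* 0≤f 0≤h)) ⟩
      T ℚ.* f ℚ.* (κ ℚ.* (h′ ℚ.- h)) ℚ.+ ν ℚ.* A
        ≤⟨ ℚ.+-mono-≤ (*-monoʳ-≤-0≤ (0≤* 0≤T 0≤f) tail) A≤ ⟩
      T ℚ.* f ℚ.* c ℚ.+ c ℚ.* f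
        -- Three copies of c f are rounded up to four, which is `T ℚ.* f ℚ.* (c ℚ.+ c)` and fits
        -- `ε≥`.
        ≤⟨ p≤p+q (0≤* 0≤c 0≤f) ⟩
      (T ℚ.* f ℚ.* c ℚ.+ c ℚ.* f) ℚ.+ c ℚ.* f
        ≡⟨ solve 2 (λ f c → ((con 1ℚ :+ con 1ℚ) :* f :* c :+ c :* f) :+ c :* f :=
             (con 1ℚ :+ con 1ℚ) :* f :* (c :+ c)) refl f c ⟩
      T ℚ.* f ℚ.* (c ℚ.+ c)
        ≤⟨ *-monoʳ-≤-0≤ (0≤* 0≤T 0≤f) 2c≤ ⟩
      T ℚ.* f ℚ.* (h′ ℚ.* (ε ℚ.* κ))
        ≡⟨ target ⟩
      ε ℚ.* (y ℚ.* h′) ℚ.* W ∎)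
      where
      2c≤ : c ℚ.+ c ℚ.≤ h′ ℚ.* (ε ℚ.* κ)
      2c≤ = begin
        c ℚ.+ c                            ≤⟨ ℚ.+-mono-≤ c≤ch′ c≤ch′ ⟩
        c ℚ.* h′ ℚ.+ c ℚ.* h′              ≤⟨ p≤p+q 0≤h′ ⟩
        c ℚ.* h′ ℚ.+ c ℚ.* h′ ℚ.+ h′       ≡⟨ solve 2 (λ c h′ → c :* h′ :+ c :* h′ :+ h′ := h′ :* (con 1ℚ :+ (c :+ c))) refl c h′ ⟩
        h′ ℚ.* (1ℚ ℚ.+ (c ℚ.+ c))          ≤⟨ *-monoʳ-≤-0≤ 0≤h′ ε≥ ⟩
        h′ ℚ.* (ε ℚ.* κ)                   ∎

  relative-error : ℚ.∣ x ℚ.- y ℚ.* h′ ∣ ℚ.≤ ε ℚ.* ℚ.∣ y ℚ.* h′ ∣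
  relative-error = subst (λ p → ℚ.∣ x ℚ.- y ℚ.* h′ ∣ ℚ.≤ ε ℚ.* p)
    (sym (ℚ.0≤p⇒∣p∣≡p (0≤* 0≤y 0≤h′))) (∣p∣≤ upper lower)

module _ (σ : List ℕ) where

  private
    a : ℕ → ℕ
    a n = ∣Av n ∣ σ

    H : ℕ → ℚ
    H = partialSum σ

    term : ℕ → ℚ
    term n = (a (suc n) ÷ n !) {{n !≢0}}

    term-! : ∀ n → term n ℚ.* ι (n !) ≡ ι (a (suc n))
    term-! n = ÷-*-ι (a (suc n)) (n !) {{n !≢0}}

    0≤term : ∀ n → 0ℚ ℚ.≤ term n
    0≤term n = ÷-nonNeg (a (suc n)) (n !) {{n !≢0}}

  partialSum-mono : ∀ {i j} → i ≤ j → H i ℚ.≤ H j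
  partialSum-mono {i} {j} i≤j with k , refl ← m≤n⇒∃[o]m+o≡n i≤j = subst (λ j → H i ℚ.≤ H j) (+-comm k i) (go k)
    where
    go : ∀ k → H i ℚ.≤ H (k + i)
    go zero    = ℚ.≤-refl
    go (suc k) = ℚ.≤-trans (go k) (p≤p+q (0≤term (k + i)))

  partialSum-1 : H 1 ≡ ι (a 1)
  partialSum-1 = begin
    0ℚ ℚ.+ term 0       ≡⟨ ℚ.+-identityˡ (term 0) ⟩
    term 0              ≡⟨ ℚ.*-identityʳ (term 0) ⟨
    term 0 ℚ.* 1ℚ       ≡⟨ cong (term 0 ℚ.*_) ι-one ⟨
    term 0 ℚ.* ι 1      ≡⟨ term-! 0 ⟩
    ι (a 1)             ∎
    where open ≡-Reasoning

  -- Both recursions split off the largest i. The factor is a separate q because it will be a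
  -- factorial of the original k, which must stay fixed while the induction lowers k.
  antidiagonal-∑-partialSum : ∀ k q {c : ℕ → ℕ → ℕ} → (∀ i j → i + j ≡ k → ι (c i j) ≡ q ℚ.* term i) →
    ι (antidiagonal-∑ k c) ≡ q ℚ.* H (suc k)
  antidiagonal-∑-partialSum zero    q c≡ = trans (c≡ 0 0 refl) (cong (q ℚ.*_) (sym (ℚ.+-identityˡ (term 0))))
  antidiagonal-∑-partialSum (suc k) q {c} c≡ = begin
    ι (antidiagonal-∑ k (λ i j → c i (suc j)) + c (suc k) 0)
      ≡⟨ ι-+ _ (c (suc k) 0) ⟩
    ι (antidiagonal-∑ k (λ i j → c i (suc j))) ℚ.+ ι (c (suc k) 0)
      ≡⟨ cong₂ ℚ._+_ (antidiagonal-∑-partialSum k q (λ i j eq → c≡ i (suc j) (trans (+-suc i j) (cong suc eq))))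
                     (c≡ (suc k) 0 (+-identityʳ (suc k))) ⟩
    q ℚ.* H (suc k) ℚ.+ q ℚ.* term (suc k)
      ≡⟨ ℚ.*-distribˡ-+ q (H (suc k)) (term (suc k)) ⟨
    q ℚ.* H (suc (suc k)) ∎
    where open ≡-Reasoning

  ∣∉Av∣+∣Av∣-partialSum : ∀ k → ι (∣∉Av∣ σ (2 + k)) ℚ.+ ι (a (2 + k)) ≡ (1ℚ ℚ.+ 1ℚ) ℚ.* (ι (k !) ℚ.* H (suc k))
  ∣∉Av∣+∣Av∣-partialSum k = begin
    ι (∣∉Av∣ σ (2 + k)) ℚ.+ ι (a (2 + k))    ≡⟨ ι-+ _ (a (2 + k)) ⟨
    ι (∣∉Av∣ σ (2 + k) + a (2 + k))          ≡⟨ cong ι (∣∉Av∣+∣Av∣ σ k) ⟩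
    ι (2 * antidiagonal-∑ k c)               ≡⟨ ι-* 2 _ ⟩
    ι 2 ℚ.* ι (antidiagonal-∑ k c)           ≡⟨ cong₂ ℚ._*_ (trans (ι-+ 1 1) (cong₂ ℚ._+_ ι-one ι-one))
                                                  (antidiagonal-∑-partialSum k (ι (k !)) summand) ⟩
    (1ℚ ℚ.+ 1ℚ) ℚ.* (ι (k !) ℚ.* H (suc k))  ∎
    where
    open ≡-Reasoning
    c : ℕ → ℕ → ℕ
    c i j = binomial i j * (j ! * a (suc i))
    -- Since `binomial i j * j !` is k!/i!, the summand is k! times the term |Av_{i+1}(σ)|/i! of the
    -- series.
    summand : ∀ i j → i + j ≡ k → ι (c i j) ≡ ι (k !) ℚ.* term i
    summand i j refl = begin
      ι (binomial i j * (j ! * a (suc i)))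
        ≡⟨ cong ι (*-assoc (binomial i j) (j !) (a (suc i))) ⟨
      ι (binomial i j * j ! * a (suc i))
        ≡⟨ ι-* _ (a (suc i)) ⟩
      ι (binomial i j * j !) ℚ.* ι (a (suc i))
        ≡⟨ cong (ι (binomial i j * j !) ℚ.*_) (trans (sym (term-! i)) (ℚ.*-comm (term i) (ι (i !)))) ⟩
      ι (binomial i j * j !) ℚ.* (ι (i !) ℚ.* term i)
        ≡⟨ ℚ.*-assoc (ι (binomial i j * j !)) (ι (i !)) (term i) ⟨
      ι (binomial i j * j !) ℚ.* ι (i !) ℚ.* term i
        ≡⟨ cong (ℚ._* term i) (ι-* _ (i !)) ⟨
      ι (binomial i j * j ! * i !) ℚ.* term i
        ≡⟨ cong (λ n → ι n ℚ.* term i) (begin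
             binomial i j * j ! * i !     ≡⟨ *-assoc (binomial i j) (j !) (i !) ⟩
             binomial i j * (j ! * i !)   ≡⟨ cong (binomial i j *_) (*-comm (j !) (i !)) ⟩
             binomial i j * (i ! * j !)   ≡⟨ binomial-! i j ⟩
             (i + j) !                    ∎) ⟩
      ι ((i + j) !) ℚ.* term i ∎

  -- The second hypothesis says that C = 0 unless |Av_1(σ)| ≥ 1: if |σ| ≤ 1 the limit is 0 and the relative
  -- error can only be bounded because Prob[∉Av] vanishes exactly.
  module _ {C : ℕ} (bound : ∀ n → n * (n * n) * a n ≤ C * n !) (C≤ : C ≤ C * a 1) where

    private
      -- One factor of the cubic bound is spent on turning (n+1)! into the denominator n! of the
      -- series, so that `term n` is at most C/(n+1)².
      n²a≤ : ∀ n → suc n * suc n * a (suc n) ≤ C * n !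
      n²a≤ n = *-cancelˡ-≤ (suc n) (begin
        suc n * (suc n * suc n * a (suc n))     ≡⟨ *-assoc (suc n) (suc n * suc n) (a (suc n)) ⟨
        suc n * (suc n * suc n) * a (suc n)     ≤⟨ bound (suc n) ⟩
        C * (suc n * n !)                       ≡⟨ solve 3 (λ C n m → C :* (n :* m) := n :* (C :* m)) refl C (suc n) (n !) ⟩
        suc n * (C * n !)                       ∎)
        where
        open ≤-Reasoning
        open +-*-Solver

      -- A telescoping majorant of the tail after `H (suc n)`: its decrement C/((n+1)(n+2)) exceeds
      -- the bound C/(n+2)² on `term (suc n)`.
      remainder : ℕ → ℚ
      remainder n = C ÷ suc n

      term≤ : ∀ n → term (suc n) ℚ.+ remainder (suc n) ℚ.≤ remainder n
      term≤ n = begin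
        term (suc n) ℚ.+ remainder (suc n)
          ≤⟨ ℚ.+-monoˡ-≤ (remainder (suc n)) (÷-mono-≤ (a (2 + n)) (suc n !) C (suc n * (2 + n)) {{suc n !≢0}} numerators) ⟩
        C ÷ (suc n * (2 + n)) ℚ.+ remainder (suc n)
          ≡⟨ ÷-+ C (suc n * (2 + n)) C (2 + n) ⟩
        (C * (2 + n) + C * (suc n * (2 + n))) ÷ (suc n * (2 + n) * (2 + n))
          ≡⟨ ÷-≡ (C * (2 + n) + C * (suc n * (2 + n))) (suc n * (2 + n) * (2 + n)) C (suc n)
               (solve 2 (λ C n → (C :* (con 2 :+ n) :+ C :* ((con 1 :+ n) :* (con 2 :+ n))) :* (con 1 :+ n) :=
                 C :* ((con 1 :+ n) :* (con 2 :+ n) :* (con 2 :+ n))) refl C n) ⟩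
        remainder n ∎
        where
        open ℚ.≤-Reasoning
        open +-*-Solver
        numerators : a (2 + n) * (suc n * (2 + n)) ≤ C * suc n !
        numerators = ≤-trans (*-monoʳ-≤ (a (2 + n)) (*-monoˡ-≤ (2 + n) (n≤1+n (suc n))))
          (≤-trans (≤-reflexive (*-comm (a (2 + n)) ((2 + n) * (2 + n)))) (n²a≤ (suc n)))

      partialSum+remainder : ∀ k n → H (suc (k + n)) ℚ.+ remainder (k + n) ℚ.≤ H (suc n) ℚ.+ remainder n
      partialSum+remainder zero    n = ℚ.≤-refl
      partialSum+remainder (suc k) n = begin
        H (suc (k + n)) ℚ.+ term (suc (k + n)) ℚ.+ remainder (suc (k + n))
          ≡⟨ ℚ.+-assoc (H (suc (k + n))) _ _ ⟩
        H (suc (k + n)) ℚ.+ (term (suc (k + n)) ℚ.+ remainder (suc (k + n)))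
          ≤⟨ ℚ.+-monoʳ-≤ (H (suc (k + n))) (term≤ (k + n)) ⟩
        H (suc (k + n)) ℚ.+ remainder (k + n)
          ≤⟨ partialSum+remainder k n ⟩
        H (suc n) ℚ.+ remainder n ∎
        where open ℚ.≤-Reasoning

    partialSum-tail : ∀ {i j} .{{_ : NonZero i}} → i ≤ j → ι i ℚ.* (H j ℚ.- H i) ℚ.≤ ι C
    partialSum-tail {suc i} {j} i<j = let k , i+k≡j = m≤n⇒∃[o]m+o≡n i<j in
      subst (λ j → ι (suc i) ℚ.* (H j ℚ.- H (suc i)) ℚ.≤ ι C) (trans (cong suc (+-comm k i)) i+k≡j) (tail k)
      where
      open ℚ.≤-Reasoning
      open ℚSolver.+-*-Solver
      diff≤ : ∀ k → H (suc (k + i)) ℚ.- H (suc i) ℚ.≤ remainder i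
      diff≤ k = begin
        H (suc (k + i)) ℚ.- H (suc i)                           ≤⟨ ℚ.+-monoˡ-≤ (ℚ.- H (suc i)) (p≤p+q {H (suc (k + i))} (÷-nonNeg C (suc (k + i)))) ⟩
        (H (suc (k + i)) ℚ.+ remainder (k + i)) ℚ.- H (suc i)   ≤⟨ ℚ.+-monoˡ-≤ (ℚ.- H (suc i)) (partialSum+remainder k i) ⟩
        (H (suc i) ℚ.+ remainder i) ℚ.- H (suc i)               ≡⟨ solve 2 (λ p q → (p :+ q) :- p := q) refl (H (suc i)) (remainder i) ⟩
        remainder i                                             ∎
      tail : ∀ k → ι (suc i) ℚ.* (H (suc (k + i)) ℚ.- H (suc i)) ℚ.≤ ι C
      tail k = begin
        ι (suc i) ℚ.* (H (suc (k + i)) ℚ.- H (suc i))  ≤⟨ *-monoʳ-≤-0≤ (0≤ι (suc i)) (diff≤ k) ⟩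
        ι (suc i) ℚ.* remainder i                      ≡⟨ ℚ.*-comm (ι (suc i)) (remainder i) ⟩
        remainder i ℚ.* ι (suc i)                      ≡⟨ ÷-*-ι C (suc i) ⟩
        ι C                                            ∎

    partialSum-cauchy : Cauchy H
    partialSum-cauchy ε 0<ε = let N , C≤εn = archimedean ε 0<ε C in
      -- Starting beyond N makes the smaller index positive, as `partialSum-tail` divides by it.
      suc N , λ i j N<i N<j → close C≤εn N<i N<j
      where
      ordered : ∀ {N} → (∀ n → N ≤ n → ι C ℚ.≤ ε ℚ.* ι n) → ∀ {i j} → N < i → i ≤ j → ℚ.∣ H j ℚ.- H i ∣ ℚ.≤ ε
      ordered C≤εn {suc i} {j} N<i i≤j = subst (ℚ._≤ ε)
        (sym (ℚ.0≤p⇒∣p∣≡p (subst (ℚ._≤ H j ℚ.- H (suc i)) (ℚ.+-inverseʳ (H (suc i)))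
                                  (ℚ.+-monoˡ-≤ (ℚ.- H (suc i)) (partialSum-mono i≤j)))))
        (ℚ.*-cancelˡ-≤-pos (ι (suc i)) (begin
          ι (suc i) ℚ.* (H j ℚ.- H (suc i))   ≤⟨ partialSum-tail i≤j ⟩
          ι C                                 ≤⟨ C≤εn (suc i) (<⇒≤ N<i) ⟩
          ε ℚ.* ι (suc i)                     ≡⟨ ℚ.*-comm ε (ι (suc i)) ⟩
          ι (suc i) ℚ.* ε                     ∎))
        where open ℚ.≤-Reasoning
      close : ∀ {N} → (∀ n → N ≤ n → ι C ℚ.≤ ε ℚ.* ι n) → ∀ {i j} → N < i → N < j → ℚ.∣ H i ℚ.- H j ∣ ℚ.≤ ε
      close C≤εn {i} {j} N<i N<j with ≤-total i j
      ... | inj₂ j≤i = ordered C≤εn N<j j≤i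
      ... | inj₁ i≤j = subst (ℚ._≤ ε) (trans (sym (ℚ.∣-p∣≡∣p∣ (H j ℚ.- H i))) (cong ℚ.∣_∣ neg)) (ordered C≤εn N<i i≤j)
        where
        open ℚSolver.+-*-Solver
        neg : ℚ.- (H j ℚ.- H i) ≡ H i ℚ.- H j
        neg = solve 2 (λ p q → :- (p :- q) := q :- p) refl (H j) (H i)

    limit : ℝ
    limit = mkℝ H partialSum-cauchy

    -- The real number `limit` is represented by H itself, so its Cauchy property is already the
    -- convergence.
    partialSum⟶limit : (λ N → fromℚ (H N)) ⟶ limit
    partialSum⟶limit ε 0<ε = let N , close = partialSum-cauchy ε 0<ε in
      N , λ n N≤n ε′ 0<ε′ → N , λ l N≤l → ℚ.≤-trans (close n l N≤n N≤l) (p≤p+q (ℚ.<⇒≤ 0<ε′))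

    -- The index l runs over the rational approximations `H l` of h. The bound is uniform in l, so
    -- it passes to the comparison of reals.
    Prob-error : ∀ ε k l → ι (1 + 2 * C) ℚ.≤ ε ℚ.* ι (suc k) → suc k ≤ l →
      ℚ.∣ Prob[∉Av] σ 2 (2 + k) ℚ.- 2/ (2 + k) ² ℚ.* H l ∣ ℚ.≤ ε ℚ.* ℚ.∣ 2/ (2 + k) ² ℚ.* H l ∣
    Prob-error ε k l ε≥ k<l = relative-error
      {Prob[∉Av] σ 2 (2 + k)} {2/ (2 + k) ²} {ε} {H (suc k)} {H l} {ι (k !)} {ι (suc k)} {ι C} {ι (a (2 + k))} {ι (∣∉Av∣ σ (2 + k))}
      (ℚ.positive⁻¹ (ι (suc k))) (ℚ.positive⁻¹ (ι (k !)) {{ι-pos {{k !≢0}}}})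
      (÷-nonNeg 2 ((2 + k) ^ 2) {{m^n≢0 (2 + k) 2}}) (partialSum-mono {0} {suc k} z≤n) (0≤ι C) (0≤ι (a (2 + k)))
      prob (∣∉Av∣+∣Av∣-partialSum k) 2/n² (partialSum-mono {suc k} {l} k<l) (partialSum-tail {suc k} {l} k<l) small C≤CH
      (subst (ℚ._≤ ε ℚ.* ι (suc k)) ι-1+2C ε≥)
      where
      ι-suc : ∀ n → ι (suc n) ≡ 1ℚ ℚ.+ ι n
      ι-suc n = trans (ι-+ 1 n) (cong (ℚ._+ ι n) ι-one)
      ι-1+2C : ι (1 + 2 * C) ≡ 1ℚ ℚ.+ (ι C ℚ.+ ι C)
      ι-1+2C = trans (ι-suc (2 * C)) (cong (1ℚ ℚ.+_) (trans (cong (λ n → ι (C + n)) (+-identityʳ C)) (ι-+ C C)))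
      prob : Prob[∉Av] σ 2 (2 + k) ℚ.* ((1ℚ ℚ.+ ι (suc k)) ℚ.* (ι (suc k) ℚ.* ι (k !))) ≡ ι (∣∉Av∣ σ (2 + k))
      prob = begin
        Prob[∉Av] σ 2 (2 + k) ℚ.* ((1ℚ ℚ.+ ι (suc k)) ℚ.* (ι (suc k) ℚ.* ι (k !)))
          ≡⟨ cong (Prob[∉Av] σ 2 (2 + k) ℚ.*_) (cong₂ ℚ._*_ (ι-suc (suc k)) (ι-* (suc k) (k !))) ⟨
        Prob[∉Av] σ 2 (2 + k) ℚ.* (ι (2 + k) ℚ.* ι (suc k !))
          ≡⟨ cong (Prob[∉Av] σ 2 (2 + k) ℚ.*_) (ι-* (2 + k) (suc k !)) ⟨
        Prob[∉Av] σ 2 (2 + k) ℚ.* ι ((2 + k) !)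
          ≡⟨ cong (λ n → Prob[∉Av] σ 2 (2 + k) ℚ.* ι n) (length-𝒮 (2 + k)) ⟨
        Prob[∉Av] σ 2 (2 + k) ℚ.* ι (length (𝒮 (2 + k)))
          ≡⟨ ÷-*-ι (∣∉Av∣ σ (2 + k)) (length (𝒮 (2 + k))) {{∣𝒮∣≢0 (2 + k)}} ⟩
        ι (∣∉Av∣ σ (2 + k)) ∎
        where open ≡-Reasoning
      2/n² : 2/ (2 + k) ² ℚ.* ((1ℚ ℚ.+ ι (suc k)) ℚ.* (1ℚ ℚ.+ ι (suc k))) ≡ 1ℚ ℚ.+ 1ℚ
      2/n² = begin
        2/ (2 + k) ² ℚ.* ((1ℚ ℚ.+ ι (suc k)) ℚ.* (1ℚ ℚ.+ ι (suc k)))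
          ≡⟨ cong (λ p → 2/ (2 + k) ² ℚ.* (p ℚ.* p)) (ι-suc (suc k)) ⟨
        2/ (2 + k) ² ℚ.* (ι (2 + k) ℚ.* ι (2 + k))
          ≡⟨ cong (2/ (2 + k) ² ℚ.*_) (ι-* (2 + k) (2 + k)) ⟨
        2/ (2 + k) ² ℚ.* ι ((2 + k) * (2 + k))
          ≡⟨ cong (λ n → 2/ (2 + k) ² ℚ.* ι ((2 + k) * n)) (*-identityʳ (2 + k)) ⟨
        2/ (2 + k) ² ℚ.* ι ((2 + k) ^ 2)
          ≡⟨ ÷-*-ι 2 ((2 + k) ^ 2) {{m^n≢0 (2 + k) 2}} ⟩
        ι 2
          ≡⟨ trans (ι-suc 1) (cong (1ℚ ℚ.+_) ι-one) ⟩
        1ℚ ℚ.+ 1ℚ ∎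
        where open ≡-Reasoning
      -- For n = 2 + k and p_n = |Av_n(σ)|/n! this says n²(n-1) p_n ≤ C, which is the form in which
      -- n² p_n → 0 enters.
      na≤ : (2 + k) * a (2 + k) ≤ C * k !
      na≤ = *-cancelˡ-≤ (2 + k) (begin
        (2 + k) * ((2 + k) * a (2 + k))   ≡⟨ *-assoc (2 + k) (2 + k) (a (2 + k)) ⟨
        (2 + k) * (2 + k) * a (2 + k)     ≤⟨ n²a≤ (suc k) ⟩
        C * (suc k * k !)                 ≤⟨ *-monoʳ-≤ C (*-monoˡ-≤ (k !) (n≤1+n (suc k))) ⟩
        C * ((2 + k) * k !)               ≡⟨ solve 3 (λ C n m → C :* (n :* m) := n :* (C :* m)) refl C (2 + k) (k !) ⟩
        (2 + k) * (C * k !)               ∎)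
        where
        open ≤-Reasoning
        open +-*-Solver
      small : (1ℚ ℚ.+ ι (suc k)) ℚ.* ι (a (2 + k)) ℚ.≤ ι C ℚ.* ι (k !)
      small = subst₂ ℚ._≤_ (trans (ι-* (2 + k) (a (2 + k))) (cong (ℚ._* ι (a (2 + k))) (ι-suc (suc k))))
                           (ι-* C (k !)) (ι-mono-≤ na≤)
      C≤CH : ι C ℚ.≤ ι C ℚ.* H l
      C≤CH = begin
        ι C               ≤⟨ ι-mono-≤ C≤ ⟩
        ι (C * a 1)       ≡⟨ ι-* C (a 1) ⟩
        ι C ℚ.* ι (a 1)   ≡⟨ cong (ι C ℚ.*_) partialSum-1 ⟨
        ι C ℚ.* H 1       ≤⟨ *-monoʳ-≤-0≤ (0≤ι C) (partialSum-mono {1} {l} (≤-trans (s≤s z≤n) k<l)) ⟩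
        ι C ℚ.* H l       ∎
        where open ℚ.≤-Reasoning

    Prob∼ : (λ n → fromℚ (Prob[∉Av] σ 2 n)) ∼ (λ n → 2/ n ² ·ʳ limit)
    -- The count relies on the presence of both entries 1 and 2, so n = 2 + k; the offset 2 rules
    -- out smaller n.
    Prob∼ ε 0<ε = let N , ε≥ = archimedean ε 0<ε (1 + 2 * C) in 2 + N , λ where
      (suc zero)    (s≤s ())
      (suc (suc k)) (s≤s (s≤s N≤k)) ε′ 0<ε′ → suc k , λ l k<l →
        ℚ.≤-trans (Prob-error ε k l (ε≥ (suc k) (m≤n⇒m≤1+n N≤k)) k<l) (p≤p+q (ℚ.<⇒≤ 0<ε′))

-- Bounds on |Av_n(σ)|

avoids-≺ : ∀ {σ π} → σ ≺ π → avoids σ π ≡ 0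
avoids-≺ {σ} {π} σ≺π with σ ≺? π
... | yes _   = refl
... | no σ⊀π = ⊥-elim (σ⊀π σ≺π)

avoids-⊀ : ∀ {σ π} → ¬ σ ≺ π → avoids σ π ≡ 1
avoids-⊀ {σ} {π} σ⊀π with σ ≺? π
... | yes σ≺π = ⊥-elim (σ⊀π σ≺π)
... | no _    = refl

≺-nonempty : ∀ σ x π → length σ ≤ 1 → σ ≺ x ∷ π
≺-nonempty []          x π _ = [] , minimum _ , refl , []
≺-nonempty (_ ∷ [])    x π _ = x ∷ [] , refl ∷ minimum π , refl , [] ∷ []
≺-nonempty (_ ∷ _ ∷ _) x π (s≤s ())

≺⇒length≤ : ∀ {σ π} → σ ≺ π → length σ ≤ length π
≺⇒length≤ {π = π} (τ , τ⊆π , len , _) = subst (_≤ length π) len (length-mono-≤ τ⊆π)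

length-∈𝒮 : ∀ m {σ} → σ ∈ 𝒮 m → length σ ≡ m
length-∈𝒮 m σ∈ = trans (↭-length (∈𝒮⇒↭ m σ∈)) (length-applyUpTo suc m)

∣Av∣≡0 : ∀ σ → length σ ≤ 1 → ∀ n → ∣Av suc n ∣ σ ≡ 0
∣Av∣≡0 σ len n = trans (∣Av∣≡∑ σ (suc n)) (trans
  (∑-cong (perms [1⋯ suc n ]) (λ {π} π∈ → contained π (length-perms-∈ [1⋯ suc n ] π∈)))
  (∑-zero (perms [1⋯ suc n ])))
  where
  contained : ∀ π → length π ≡ length [1⋯ suc n ] → avoids σ π ≡ 0
  contained (x ∷ π) _ = avoids-≺ (≺-nonempty σ x π len)

-- If |σ| ≤ 1, every nonempty permutation contains σ and C = 0 is possible. Otherwise the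
-- permutation of size 1 avoids σ, and the second condition is an equality.
∣Av∣-bound : ∀ m σ → σ ∈ 𝒮 m → ∃[ C ] ((∀ n → n * (n * n) * ∣Av n ∣ σ ≤ C * n !) × C ≤ C * ∣Av 1 ∣ σ)
∣Av∣-bound m σ σ∈ with length σ ≤? 1
... | yes len = 0 , trivial , z≤n
  where
  trivial : ∀ n → n * (n * n) * ∣Av n ∣ σ ≤ 0
  -- The cube takes care of n = 0, where |Av_0(σ)| can be 1.
  trivial zero    = z≤n
  trivial (suc n) = ≤-reflexive (trans (cong (suc n * (suc n * suc n) *_) (∣Av∣≡0 σ len n)) (*-zeroʳ (suc n * (suc n * suc n))))
... | no 1≱len = let C , bound = cubic-bound {a} {m} {pred (m !)} m>0 (sym (suc-pred (m !) {{m !≢0}})) (∣Av∣≤! σ) step in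
  C , bound , ≤-reflexive (sym (trans (cong (C *_) ∣Av₁∣) (*-identityʳ C)))
  where
  a : ℕ → ℕ
  a n = ∣Av n ∣ σ
  m>0 : 0 < m
  m>0 = subst (0 <_) (length-∈𝒮 m σ∈) (<⇒≤ (≰⇒> 1≱len))
  ∣Av₁∣ : a 1 ≡ 1
  ∣Av₁∣ = trans (∣Av∣≡∑ σ 1) (cong (_+ 0) (avoids-⊀ (λ σ≺ → 1≱len (≺⇒length≤ σ≺))))
  step : ∀ n → a (m + n) * (m ! * n !) ≤ (m + n) ! * (pred (m !) * a n)
  step n = begin
    a (m + n) * (m ! * n !)                            ≤⟨ *-monoˡ-≤ (m ! * n !) (∣Av∣-submultiplicative σ m n) ⟩
    binomial m n * (a m * a n) * (m ! * n !)           ≡⟨ solve 3 (λ x y z → x :* y :* z := x :* z :* y) refl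
                                                            (binomial m n) (a m * a n) (m ! * n !) ⟩
    binomial m n * (m ! * n !) * (a m * a n)           ≡⟨ cong (_* (a m * a n)) (binomial-! m n) ⟩
    (m + n) ! * (a m * a n)                            ≤⟨ *-monoʳ-≤ ((m + n) !) (*-monoˡ-≤ (a n) (<⇒≤pred (∣Av∣<! m σ∈))) ⟩
    (m + n) ! * (pred (m !) * a n)                     ∎
    where
    open ≤-Reasoning
    open +-*-Solver

mainTheorem5 : ∀ (m : ℕ) (σ : List ℕ) → σ ∈ 𝒮 m →
    ∃[ h ] ( ((λ n → fromℚ (partialSum σ (n ∸ 1 ∸ length σ))) ⟶ h)
    × ((λ N → fromℚ (partialSum σ N)) ⟶ h)
    × ((λ n → fromℚ (Prob[∉Av] σ 2 n)) ∼ (λ n → (2/ n ²) ·ʳ h)) )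
mainTheorem5 m σ σ∈ = let C , bound , C≤ = ∣Av∣-bound m σ σ∈ in
  limit σ bound C≤ ,
  -- The first limit reindexes the second: n - 1 - |σ| ≥ N once n ≥ N + 1 + |σ|.
  (λ ε 0<ε → let N , close = partialSum⟶limit σ bound C≤ ε 0<ε in
    N + (1 + length σ) , λ n N≤n → close (n ∸ 1 ∸ length σ)
      (subst (N ≤_) (sym (∸-+-assoc n 1 (length σ))) (m+n≤o⇒m≤o∸n N N≤n))) ,
  partialSum⟶limit σ bound C≤ ,
  Prob∼ σ bound C≤
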